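{- Let $m,n$ be positive integers. There are explicit bijections between each pair of the following sets: (1) the set of $m\times n$ partial alternating sign matrices; (2) the set of $(m,n)$-partial monotone triangles; (3) the set of $(m,n)$-partial height-function matrices; (4) the set of $(m,n)$-partial fully-packed loop configurations; (5) the set of $(m,n)$-rectangular ice configurations; (6) the set $J(\mathbf{P}_{m,n})$ of order ideals of the poset $\mathbf{P}_{m,n}$; (7) the set of $(m,n)$-nests of osculating paths. (In particular all seven sets have the same cardinality.)
   Context: An $m\times n$ partial alternating sign matrix is an $m\times n$ matrix with entries in $\{ -1,0,1\}$ such that: the entries of each row and of each column sum to $0$ or $1$; the nonzero entries in each row and in each column alternate in sign; in each column the first (topmost) nonzero entry, if any, is $1$, and in each row the last (rightmost) nonzero entry, if any, is $1$. An $(m,n)$-partial monotone triangle is a triangular array with rows $r=1,\dots,m$, row $r$ consisting of entries $b_{r,1},\dots,b_{r,r}\in\{0,1,\dots,n\}$, such that each row is weakly increasing ($b_{r,s}\le b_{r,s+1}$), the nonzero entries of each row are strictly increasing, and diagonals are weakly increasing in the sense $b_{r+1,s}\le b_{r,s}\le b_{r+1,s+1}$ for $1\le s\le r<m$. An $(m,n)$-partial height-function matrix is an integer matrix $(h_{i,j})_{0\le i\le m,\,0\le j\le n}$ with all entries nonnegative, $h_{0,k}=k$ for $0\le k\le n$, $h_{\ell,0}=\ell$ for $0\le \ell\le m$, and such that any two horizontally or vertically adjacent entries differ by exactly $1$. The graph $G_{m,n}$ has vertex set $\{v_{i,j}:0\le i\le m+1,\ 0\le j\le n+1\}\setminus\{v_{0,0},v_{0,n+1},v_{m+1,0},v_{m+1,n+1}\}$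 and edges $v_{i,j}v_{i+1,j}$ for $0\le i\le m$, $1\le j\le n$, and $v_{i,j}v_{i,j+1}$ for $1\le i\le m$, $0\le j\le n$ ($i$ indexes rows from the top, $j$ columns from the left). Vertices $v_{i,j}$ with $1\le i\le m$, $1\le j\le n$ are interior; the others are boundary vertices. A vertex $v_{i,j}$ is even if $i+j$ is even and odd otherwise. An $(m,n)$-partial fully-packed loop configuration is a subgraph of $G_{m,n}$ (on all vertices) such that every interior vertex has exactly two incident edges, and on the top and left boundary: for $1\le j\le n$ the edge $v_{0,j}v_{1,j}$ is present if and only if $j$ is odd, and for $1\le i\le m$ the edge $v_{i,0}v_{i,1}$ is present if and only if $i$ is even (edges to the bottom and right boundary vertices are unrestricted). An $(m,n)$-rectangular ice configuration is an orientation of all edges of $G_{m,n}$ such that every edge $v_{i,0}v_{i,1}$ ($1\le i\le m$) points inward, i.e. toward $v_{i,1}$, every edge $v_{0,j}v_{1,j}$ ($1\le j\le n$) points outward, i.e. toward $v_{0,j}$, and every interior vertex has in-degree $2$ and out-degree $2$. The poset $\mathbf{P}_{m,n}$ has elements the integer triples $(i,j,k)$ with $0\le k\le m-1$, $k\le j\le n-1$, $k\le i\le m-1$, and partial order generated by the covering relations: $(i,j,k)$ covers each of $(i+1,j,k)$, $(i,j+1,k)$, $(i-1,j,k-1)$, $(i,j-1,k-1)$ that is an element of $\mathbf{P}_{m,n}$. An order ideal is a subset $X$ with $y\in X,\ z\le y\Rightarrow z\in X$; $J(P)$ is the set of order ideals. An $(m,n)$-nest of osculating paths: consider the grid of vertices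 $(r,c)$, $1\le r\le m$, $1\le c\le n$. A path is a sequence of grid vertices in which each step goes south $(r,c)\to(r+1,c)$ or east $(r,c)\to(r,c+1)$, starting at a vertex on the left side ($c=1$) and ending at a vertex on the bottom side ($r=m$); think of each path as entering its first vertex from the west and leaving its last vertex to the south. A nest is a finite set of such paths that are osculating: no two share a step, and at every vertex either at most one path passes, or exactly two paths pass, one entering from the west and leaving to the south and the other entering from the north and leaving to the east (paths may touch only at such corners, and never cross). -}

module Defs where

open import Algebra.Definitions.RawMonoid using (sum)
open import Data.Bool.Base using (Bool; T)
open import Data.Fin.Base as Fin using (Fin; zero; suc; toℕ)
open import Data.Integer.Base using (ℤ; 0ℤ; 1ℤ; -1ℤ; sign; +-0-rawMonoid)
open import Data.List.Base using (List; []; _∷_; _++_; head; last)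
open import Data.List.Membership.Propositional using (_∈_)
open import Data.List.Relation.Binary.BagAndSetEquality using (set; [_]-Equality)
open import Data.List.Relation.Unary.Linked using (Linked)
open import Data.Maybe.Base using (just)
open import Data.Nat.Base as ℕ using (ℕ; suc; _≤_; _<_; ∣_-_∣)
open import Data.Nat.Divisibility using (_∣_)
open import Data.Product.Base using (Σ; _×_; _,_; proj₁; proj₂; ∃; ∃₂; uncurry)
open import Data.Sign.Base using (opposite)
open import Data.Sum.Base using (_⊎_)
open import Data.Vec.Functional using (Vector)
open import Function.Base using (flip)
open import Function.Bundles using (_⇔_)
open import Level using (0ℓ)
open import Relation.Binary.Bundles using (Setoid)
open import Relation.Binary.Construct.Closure.ReflexiveTransitive using (Star)
import Relation.Binary.Construct.On as On
open import Relation.Binary.Core using (Rel)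
open import Relation.Binary.PropositionalEquality using (_≡_; _≢_; refl; sym; trans)
open import Relation.Nullary using (¬_)

-- A set of structures, each determined by a family of values: two structures
-- are identified when their families agree pointwise, whatever the proofs of
-- the defining conditions.

pointwise : {X I : Set} {F : I → Set} → (X → (i : I) → F i) → Setoid 0ℓ 0ℓ
pointwise {X} f = record
  { Carrier       = X
  ; _≈_           = λ x y → ∀ i → f x i ≡ f y i
  ; isEquivalence = record
    { refl  = λ _ → refl
    ; sym   = λ x≈y i → sym (x≈y i)
    ; trans = λ x≈y y≈z i → trans (x≈y i) (y≈z i)
    }
  }

------------------------------------------------------------------------
-- Partial alternating sign matrices

module _ {k : ℕ} (v : Vector ℤ k) where

  SumsTo0or1 : Set
  SumsTo0or1 = (sum +-0-rawMonoid v ≡ 0ℤ) ⊎ (sum +-0-rawMonoid v ≡ 1ℤ)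

  NonzeroEntriesAlternate : Set
  NonzeroEntriesAlternate =
    ∀ a b → a Fin.< b → v a ≢ 0ℤ → v b ≢ 0ℤ →
    (∀ c → a Fin.< c → c Fin.< b → v c ≡ 0ℤ) →
    sign (v a) ≡ opposite (sign (v b))

  FirstNonzeroIs1 : Set
  FirstNonzeroIs1 = ∀ a → v a ≢ 0ℤ → (∀ b → b Fin.< a → v b ≡ 0ℤ) → v a ≡ 1ℤ

  LastNonzeroIs1 : Set
  LastNonzeroIs1 = ∀ a → v a ≢ 0ℤ → (∀ b → a Fin.< b → v b ≡ 0ℤ) → v a ≡ 1ℤ

record PartialASM (m n : ℕ) : Set where
  field
    entry : Fin m → Fin n → ℤ

  row : Fin m → Vector ℤ n
  row i = entry i

  column : Fin n → Vector ℤ m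
  column j i = entry i j

  field
    entry-range       : ∀ i j → (entry i j ≡ -1ℤ) ⊎ (entry i j ≡ 0ℤ) ⊎ (entry i j ≡ 1ℤ)
    row-sum           : ∀ i → SumsTo0or1 (row i)
    column-sum        : ∀ j → SumsTo0or1 (column j)
    row-alternates    : ∀ i → NonzeroEntriesAlternate (row i)
    column-alternates : ∀ j → NonzeroEntriesAlternate (column j)
    column-first      : ∀ j → FirstNonzeroIs1 (column j)
    row-last          : ∀ i → LastNonzeroIs1 (row i)

partialASMs : ℕ → ℕ → Setoid 0ℓ 0ℓ
partialASMs m n = pointwise {PartialASM m n} λ A → uncurry (PartialASM.entry A)

------------------------------------------------------------------------
-- Partial monotone triangles

-- Indices are shifted down by one: b_{r,s} is entry (r - 1) (s - 1).

record PartialMonotoneTriangle (m n : ℕ) : Set where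
  field
    entry : (r : Fin m) → Fin (suc (toℕ r)) → Fin (suc n)

    rows-weakly-increasing :
      ∀ r s s′ → toℕ s′ ≡ suc (toℕ s) → entry r s Fin.≤ entry r s′

    nonzero-strictly-increasing :
      ∀ r s s′ → s Fin.< s′ → entry r s ≢ zero → entry r s′ ≢ zero →
      entry r s Fin.< entry r s′

    diagonals-weakly-increasing :
      ∀ r r′ → toℕ r′ ≡ suc (toℕ r) →
      ∀ s t t′ → toℕ t ≡ toℕ s → toℕ t′ ≡ suc (toℕ s) →
      (entry r′ t Fin.≤ entry r s) × (entry r s Fin.≤ entry r′ t′)

partialMonotoneTriangles : ℕ → ℕ → Setoid 0ℓ 0ℓ
partialMonotoneTriangles m n =
  pointwise {PartialMonotoneTriangle m n} {Σ (Fin m) λ r → Fin (suc (toℕ r))}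
    λ b → uncurry (PartialMonotoneTriangle.entry b)

------------------------------------------------------------------------
-- Partial height-function matrices

record PartialHeightFunction (m n : ℕ) : Set where
  field
    h : Fin (suc m) → Fin (suc n) → ℕ

    top-boundary  : ∀ k → h zero k ≡ toℕ k
    left-boundary : ∀ l → h l zero ≡ toℕ l

    vertically-adjacent :
      ∀ i i′ j → toℕ i′ ≡ suc (toℕ i) → ∣ h i j - h i′ j ∣ ≡ 1
    horizontally-adjacent :
      ∀ i j j′ → toℕ j′ ≡ suc (toℕ j) → ∣ h i j - h i j′ ∣ ≡ 1

partialHeightFunctions : ℕ → ℕ → Setoid 0ℓ 0ℓ
partialHeightFunctions m n =
  pointwise {PartialHeightFunction m n} λ H → uncurry (PartialHeightFunction.h H)

------------------------------------------------------------------------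
-- The graph G_{m,n}

-- The vertex v_{i,j} is named by (i , j). The vertex set itself is not needed
-- below: a subgraph on all vertices is determined by its edges.

Vertex : Set
Vertex = ℕ × ℕ

data Edge (m n : ℕ) : Set where
  vertical   : Fin (suc m) → Fin n → Edge m n
  horizontal : Fin m → Fin (suc n) → Edge m n

-- Vertical edges have 0 ≤ i ≤ m and 1 ≤ j ≤ n, horizontal ones 1 ≤ i ≤ m and
-- 0 ≤ j ≤ n, where (i , j) is the upper, respectively left, end.

lesserEnd greaterEnd : ∀ {m n} → Edge m n → Vertex
lesserEnd  (vertical i j)   = toℕ i       , suc (toℕ j)
lesserEnd  (horizontal i j) = suc (toℕ i) , toℕ j
greaterEnd (vertical i j)   = suc (toℕ i) , suc (toℕ j)
greaterEnd (horizontal i j) = suc (toℕ i) , suc (toℕ j)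

_IncidentTo_ : ∀ {m n} → Edge m n → Vertex → Set
e IncidentTo v = (lesserEnd e ≡ v) ⊎ (greaterEnd e ≡ v)

Interior : ℕ → ℕ → Vertex → Set
Interior m n (i , j) = ((1 ≤ i) × (i ≤ m)) × ((1 ≤ j) × (j ≤ n))

ExactlyTwo : {A : Set} → (A → Set) → Set
ExactlyTwo P =
  ∃₂ λ x y → (x ≢ y) × P x × P y × (∀ z → P z → (z ≡ x) ⊎ (z ≡ y))

------------------------------------------------------------------------
-- Partial fully-packed loop configurations

Even Odd : ℕ → Set
Even k = 2 ∣ k
Odd  k = ¬ (2 ∣ k)

record PartialFPL (m n : ℕ) : Set where
  field
    present : Edge m n → Bool

    interior-degree :
      ∀ v → Interior m n v → ExactlyTwo λ e → (e IncidentTo v) × T (present e)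

    top-boundary  : ∀ j → T (present (vertical zero j)) ⇔ Odd (suc (toℕ j))
    left-boundary : ∀ i → T (present (horizontal i zero)) ⇔ Even (suc (toℕ i))

partialFPLs : ℕ → ℕ → Setoid 0ℓ 0ℓ
partialFPLs m n = pointwise {PartialFPL m n} PartialFPL.present

------------------------------------------------------------------------
-- Rectangular ice configurations

data Direction : Set where
  toLesser toGreater : Direction

Orientation : ℕ → ℕ → Set
Orientation m n = Edge m n → Direction

module _ {m n : ℕ} (o : Orientation m n) where

  target : Edge m n → Vertex
  target e with o e
  ... | toLesser  = lesserEnd e
  ... | toGreater = greaterEnd e

  source : Edge m n → Vertex
  source e with o e
  ... | toLesser  = greaterEnd e
  ... | toGreater = lesserEnd e

record RectangularIce (m n : ℕ) : Set where
  field
    orientation : Orientation m n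

    left-inward :
      ∀ i → target orientation (horizontal i zero) ≡ (suc (toℕ i) , 1)
    top-outward :
      ∀ j → target orientation (vertical zero j) ≡ (0 , suc (toℕ j))

    in-degree :
      ∀ v → Interior m n v → ExactlyTwo λ e → target orientation e ≡ v
    out-degree :
      ∀ v → Interior m n v → ExactlyTwo λ e → source orientation e ≡ v

rectangularIces : ℕ → ℕ → Setoid 0ℓ 0ℓ
rectangularIces m n = pointwise {RectangularIce m n} RectangularIce.orientation

------------------------------------------------------------------------
-- Order ideals of P_{m,n}

-- The bounds are irrelevant so that elements with equal coordinates are equal.

record P (m n : ℕ) : Set where
  constructor ⟨_,_,_⟩
  field
    i j k : ℕ
    .{k<m} : k < m
    .{k≤j} : k ≤ j
    .{j<n} : j < n
    .{k≤i} : k ≤ i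
    .{i<m} : i < m

module _ {m n : ℕ} where

  open P

  data _Covers_ (x y : P m n) : Set where
    i+1     : i y ≡ suc (i x) → j y ≡ j x → k y ≡ k x → x Covers y
    j+1     : i y ≡ i x → j y ≡ suc (j x) → k y ≡ k x → x Covers y
    i-1,k-1 : suc (i y) ≡ i x → j y ≡ j x → suc (k y) ≡ k x → x Covers y
    j-1,k-1 : i y ≡ i x → suc (j y) ≡ j x → suc (k y) ≡ k x → x Covers y

  _≤P_ : Rel (P m n) 0ℓ
  _≤P_ = Star (flip _Covers_)

-- Subsets are Bool-valued: the poset is finite, and membership is decidable.

record OrderIdeal {A : Set} (_⊑_ : Rel A 0ℓ) : Set where
  field
    member      : A → Bool
    down-closed : ∀ {y z} → T (member y) → z ⊑ y → T (member z)

orderIdeals : ℕ → ℕ → Setoid 0ℓ 0ℓ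
orderIdeals m n = pointwise {OrderIdeal (_≤P_ {m} {n})} OrderIdeal.member

------------------------------------------------------------------------
-- Nests of osculating paths

module _ {m n : ℕ} where

  -- The grid vertex (r , c) in 1-based coordinates is (r - 1 , c - 1) here.

  GridVertex : Set
  GridVertex = Fin m × Fin n

  SouthStep EastStep Step : Rel GridVertex 0ℓ
  SouthStep (r , c) (r′ , c′) = (toℕ r′ ≡ suc (toℕ r)) × (c′ ≡ c)
  EastStep  (r , c) (r′ , c′) = (r′ ≡ r) × (toℕ c′ ≡ suc (toℕ c))
  Step u v = SouthStep u v ⊎ EastStep u v

  StartsAt EndsAt : List GridVertex → GridVertex → Set
  StartsAt p v = head p ≡ just v
  EndsAt   p v = last p ≡ just v

  record IsPath (p : List GridVertex) : Set where
    field
      steps  : Linked Step p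
      starts : ∃ λ v → StartsAt p v × (toℕ (proj₂ v) ≡ 0)
      ends   : ∃ λ v → EndsAt p v × (suc (toℕ (proj₁ v)) ≡ m)

  HasStep : List GridVertex → GridVertex → GridVertex → Set
  HasStep p u v = ∃₂ λ xs ys → p ≡ xs ++ u ∷ v ∷ ys

  module _ (p : List GridVertex) (v : GridVertex) where

    EntersFromWest EntersFromNorth LeavesToSouth LeavesToEast : Set
    EntersFromWest  = StartsAt p v ⊎ (∃ λ u → EastStep u v × HasStep p u v)
    EntersFromNorth = ∃ λ u → SouthStep u v × HasStep p u v
    LeavesToSouth   = EndsAt p v ⊎ (∃ λ w → SouthStep v w × HasStep p v w)
    LeavesToEast    = ∃ λ w → EastStep v w × HasStep p v w

  module _ (N : List (List GridVertex)) (v : GridVertex) where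

    AtMostOnePasses : Set
    AtMostOnePasses = ∀ p q → p ∈ N → q ∈ N → v ∈ p → v ∈ q → p ≡ q

    TwoTouch : Set
    TwoTouch = ∃₂ λ p q → p ∈ N × q ∈ N × (p ≢ q) × v ∈ p × v ∈ q ×
      (∀ s → s ∈ N → v ∈ s → (s ≡ p) ⊎ (s ≡ q)) ×
      (EntersFromWest p v × LeavesToSouth p v) ×
      (EntersFromNorth q v × LeavesToEast q v)

-- A finite set of paths is a list of paths, up to having the same members;
-- neither order nor repetition in the list matters.

record Nest (m n : ℕ) : Set where
  field
    paths     : List (List (GridVertex {m} {n}))
    all-paths : ∀ p → p ∈ paths → IsPath p

    no-shared-step :
      ∀ p q → p ∈ paths → q ∈ paths → p ≢ q →
      ∀ u v → ¬ (HasStep p u v × HasStep q u v)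

    osculating : ∀ v → AtMostOnePasses paths v ⊎ TwoTouch paths v

nests : ℕ → ℕ → Setoid 0ℓ 0ℓ
nests m n = On.setoid ([ set ]-Equality (List (GridVertex {m} {n}))) (Nest.paths)

------------------------------------------------------------------------
-- The seven families

data Family : Set where
  pasm triangle height fpl ice ideal nest : Family

setOf : Family → ℕ → ℕ → Setoid 0ℓ 0ℓ
setOf pasm     = partialASMs
setOf triangle = partialMonotoneTriangles
setOf height   = partialHeightFunctions
setOf fpl      = partialFPLs
setOf ice      = rectangularIces
setOf ideal    = orderIdeals
setOf nest     = nests

{-# OPTIONS --safe #-}
module Submission where

-- All seven families encode the corner-sum matrices D: integer matrices indexed by
-- 0 ≤ i ≤ m, 0 ≤ j ≤ n, zero for i = 0 or j = 0, whose entries grow by 0 or 1 along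
-- each row and each column. Recording the increments as bits on the edges of
-- G_{m,n} turns D into an ice configuration, with the boundary condition that the
-- bits vanish at the top and on the left and with the condition that both ways
-- around a unit square add up to the same total. The other families are read off as follows.
--   matrices   partial sums of an alternating sign matrix reflected left to right
--   heights    h i j = i + j − 2 D i j
--   loops      increments complemented on every other edge
--   ideals     (i , j , k) ∈ X  iff  k < D (i + 1) (j + 1)
--   triangles  (i , j , k) ∈ X  iff  n ≤ j + b_{i,i−k}, with 0-based rows and entries
--   nests      the edges used by the paths, reflected left to right
-- A nest is recovered from its edges because at a vertex where two paths meet the
-- turns are forced, forwards as well as backwards.

open import Defs
open import Algebra.Definitions.RawMonoid using (sum)
open import Data.Bool.Base using (Bool; true; false; not; T; _xor_; if_then_else_)
open import Data.Bool.Properties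
  using (T-≡; ⇔→≡; T?; not-involutive; xor-assoc; xor-same; xor-identityʳ)
open import Data.Empty using (⊥; ⊥-elim)
open import Data.Fin.Base as Fin using (Fin; zero; suc; toℕ; inject₁; opposite; fromℕ; fromℕ<)
open import Data.Fin.Induction using (<-weakInduction)
import Data.Fin.Properties as Fin
open import Data.Integer.Base as ℤ using (ℤ; 0ℤ; 1ℤ; -1ℤ; sign; +-0-rawMonoid)
import Data.Integer.Properties as ℤ
open import Data.List.Base
  using (List; []; _∷_; _++_; _∷ʳ_; _ʳ++_; reverse; head; last; concatMap; allFin; initLast; _∷ʳ′_)
open import Data.List.Membership.Propositional using (_∈_; find; lose)
open import Data.List.Membership.Propositional.Properties
  using (∈-∃++; ∈-insert; ∈-allFin; ∈-concatMap⁺; ∈-concatMap⁻)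
open import Data.List.Properties using (∷-injective; ++-assoc; ʳ++-defn)
open import Data.List.Relation.Unary.Any as Any using (Any; here; there)
open import Data.List.Relation.Unary.Linked as Linked using (Linked; [-]; _∷_)
open import Data.Maybe.Base using (just)
open import Data.Maybe.Properties as Maybe using (just-injective)
open import Data.Nat.Base as ℕ
  using (ℕ; zero; suc; _+_; _*_; _∸_; _≤_; _<_; z≤n; s≤s; ∣_-_∣; _<ᵇ_; NonZero)
open import Data.Nat.Divisibility using (_∣_; divides; ∣m∣n⇒∣m+n; ∣m+n∣m⇒∣n; ∣1⇒≡1)
import Data.Nat.Properties as ℕ
open import Data.Nat.Tactic.RingSolver using (solve-∀)
open import Data.Product.Base using (∃; ∃₂; _×_; _,_; proj₁; proj₂; uncurry)
import Data.Product.Properties as Product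
open import Data.Sign.Base as Sign using (Sign)
import Data.Sign.Properties as Sign
open import Data.Sum.Base using (_⊎_; inj₁; inj₂)
open import Function.Base using (_∘_; id; case_of_)
open import Function.Bundles using (Bijection; _⇔_; mk⇔; Equivalence)
open import Function.Properties.Bijection as Bijection using (Bijection⇒Inverse)
open import Function.Properties.Equivalence using () renaming (trans to ⇔-trans)
open import Function.Properties.Inverse as Inverse using (Inverse⇒Bijection)
open import Level using (0ℓ)
open import Relation.Binary.Bundles using (Setoid)
open import Relation.Binary.Construct.Closure.ReflexiveTransitive using (ε; _◅_)
open import Relation.Binary.PropositionalEquality
open import Relation.Nullary using (¬_; Dec; yes; no; contradiction)
open import Relation.Nullary.Decidable
  using (True; from-yes; ⌊_⌋; toWitness; fromWitness; recompute; map′; ¬?; _×-dec_; _⊎-dec_;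
    _→-dec_)

open Equivalence using (to; from)

-- Increments are the common target because the conditions on matrices, heights, loops, ice and
-- flows then concern four bits around one vertex, and such statements are settled by evaluating all
-- cases. Ideals and triangles go through the sums themselves, since their third coordinate counts
-- up to a corner sum. The balance reads north + east = south + west: units travel down and to the
-- left, none coming in at the top and none leaving on the left. Nests travel down and to the right,
-- and the partial sums of a row of an alternating sign matrix stay 0 or 1 when taken from the
-- right; hence the two reflections. Paths are the one kind of data that is not local: they have to
-- be followed through the bits, forwards to the bottom and backwards to the left side. Both end
-- because each step passes to the next antidiagonal.

module _ {A B : Setoid 0ℓ 0ℓ} where

  private
    module A = Setoid A
    module B = Setoid B

  bijection : (f : A.Carrier → B.Carrier) → (∀ {x y} → x A.≈ y → f x B.≈ f y) →
    (∀ {x y} → f x B.≈ f y → x A.≈ y) → (∀ y → ∃ λ x → f x B.≈ y) → Bijection A B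
  bijection f f-cong f-injective f-onto = record
    { to        = f
    ; cong      = f-cong
    ; bijective = f-injective ,
        λ y → proj₁ (f-onto y) , λ z≈x → B.trans (f-cong z≈x) (proj₂ (f-onto y))
    }

-- Booleans, bits and finite indices

T⇔⇒≡ : ∀ {x y} → (T x → T y) → (T y → T x) → x ≡ y
T⇔⇒≡ f g = ⇔→≡ {z = true} (mk⇔ (to T-≡ ∘ f ∘ from T-≡) (to T-≡ ∘ g ∘ from T-≡))

T⇒≡ : ∀ {x} → T x → x ≡ true
T⇒≡ = to T-≡

bit : Bool → ℕ
bit false = 0
bit true  = 1

bit-injective : ∀ {x y} → bit x ≡ bit y → x ≡ y
bit-injective {false} {false} _ = refl
bit-injective {true}  {true}  _ = refl

bit≤1 : ∀ x → bit x ≤ 1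
bit≤1 false = z≤n
bit≤1 true  = s≤s z≤n

-- Puts the adjacency hypotheses of the definitions into a form that can be matched on.
successor : ∀ {k} {i i′ : Fin (suc k)} → toℕ i′ ≡ suc (toℕ i) →
  ∃ λ a → i ≡ inject₁ a × i′ ≡ suc a
successor {i′ = suc a} eq =
  a , Fin.toℕ-injective (trans (sym (ℕ.suc-injective eq)) (sym (Fin.toℕ-inject₁ a))) , refl

opposite-inject₁ : ∀ {k} (i : Fin k) → opposite (inject₁ i) ≡ suc (opposite i)
opposite-inject₁ zero    = refl
opposite-inject₁ (suc i) = cong inject₁ (opposite-inject₁ i)

opposite-last : ∀ k → opposite (fromℕ k) ≡ zero
opposite-last zero    = refl
opposite-last (suc k) = cong inject₁ (opposite-last k)

-- Together with `from-yes`, this proves identities about finitely many bits by evaluating every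
-- case.
∀Bool? : ∀ {Q : Bool → Set} → (∀ b → Dec (Q b)) → Dec (∀ b → Q b)
∀Bool? Q? = map′ (λ where (f , t) false → f; (f , t) true → t) (λ h → h false , h true)
  (Q? false ×-dec Q? true)

-- The increment is D i (j + 1) − D i j on the edge vertical i j, which separates the
-- entries (i , j) and (i , j + 1), and D (i + 1) j − D i j on horizontal i j.

record Increments (m n : ℕ) : Set where
  field
    increment : Edge m n → Bool
    top       : ∀ j → increment (vertical zero j) ≡ false
    left      : ∀ i → increment (horizontal i zero) ≡ false
    balance   : ∀ i j →
      bit (increment (vertical (inject₁ i) j)) + bit (increment (horizontal i (suc j))) ≡
      bit (increment (vertical (suc i) j)) + bit (increment (horizontal i (inject₁ j)))

increments : ℕ → ℕ → Setoid 0ℓ 0ℓ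
increments m n = pointwise {Increments m n} Increments.increment

-- Ice configurations and fully-packed loops

pattern 0F = zero
pattern 1F = suc zero
pattern 2F = suc (suc zero)
pattern 3F = suc (suc (suc zero))

count : (Fin 4 → Bool) → ℕ
count q = bit (q 0F) + bit (q 1F) + bit (q 2F) + bit (q 3F)

count-cong : ∀ {q q′} → (∀ a → q a ≡ q′ a) → count q ≡ count q′
count-cong q≗q′ = cong₂ _+_ (cong₂ _+_ (cong₂ _+_
  (cong bit (q≗q′ _)) (cong bit (q≗q′ _))) (cong bit (q≗q′ _))) (cong bit (q≗q′ _))

ExactlyTwo-resp : ∀ {A : Set} {Q R : A → Set} → (∀ z → Q z ⇔ R z) → ExactlyTwo Q → ExactlyTwo R
ExactlyTwo-resp Q⇔R (x , y , x≢y , Qx , Qy , only) =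
  x , y , x≢y , to (Q⇔R x) Qx , to (Q⇔R y) Qy , λ z → only z ∘ from (Q⇔R z)

-- `q` is the indicator of the two witnesses, and the sixteen pairs of witnesses are checked by
-- evaluation.
exactlyTwo⇒count : ∀ q → ExactlyTwo (T ∘ q) → count q ≡ 2
exactlyTwo⇒count q (x , y , x≢y , qx , qy , only) =
  trans (count-cong q≗pair) (case count-pair x y of λ where
    (inj₁ x≡y) → contradiction x≡y x≢y
    (inj₂ eq)  → eq)
  where
  pair : (x y z : Fin 4) → Bool
  pair x y z = ⌊ (z Fin.≟ x) ⊎-dec (z Fin.≟ y) ⌋
  count-pair : ∀ x y → x ≡ y ⊎ count (pair x y) ≡ 2
  count-pair = from-yes
    (Fin.all? λ x → Fin.all? λ y → (x Fin.≟ y) ⊎-dec (count (pair x y) ℕ.≟ 2))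
  q≗pair : ∀ z → q z ≡ pair x y z
  q≗pair z = T⇔⇒≡ (fromWitness ∘ only z) λ t → case toWitness t of λ where
    (inj₁ refl) → qx
    (inj₂ refl) → qy

count⇒exactlyTwo : ∀ q → count q ≡ 2 → ExactlyTwo (T ∘ q)
count⇒exactlyTwo q eq = ExactlyTwo-resp
  (λ z → mk⇔ (subst T (sym (q≗ z))) (subst T (q≗ z)))
  (pick (q 0F) (q 1F) (q 2F) (q 3F) eq)
  where
  -- Nothing evaluates on an abstract `q`; the table of its four values makes the decisions below
  -- compute.
  four : (a b c d : Bool) → Fin 4 → Bool
  four a b c d 0F = a
  four a b c d 1F = b
  four a b c d 2F = c
  four a b c d 3F = d
  q≗ : ∀ z → q z ≡ four (q 0F) (q 1F) (q 2F) (q 3F) z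
  q≗ 0F = refl
  q≗ 1F = refl
  q≗ 2F = refl
  q≗ 3F = refl
  -- The implicit argument is filled in by evaluation once the four truth values are known.
  two : ∀ {q} x y →
    {True (¬? (x Fin.≟ y) ×-dec T? (q x) ×-dec T? (q y) ×-dec
      Fin.all? λ z → T? (q z) →-dec ((z Fin.≟ x) ⊎-dec (z Fin.≟ y)))} →
    ExactlyTwo (T ∘ q)
  two x y {t} = x , y , toWitness t
  pick : ∀ a b c d → count (four a b c d) ≡ 2 → ExactlyTwo (T ∘ (four a b c d))
  pick false false false false ()
  pick false false true  false ()
  pick true  true  false false _ = two 0F 1F
  pick true  false true  false _ = two 0F 2F
  pick true  false false true  _ = two 0F 3F
  pick false true  true  false _ = two 1F 2F
  pick false true  false true  _ = two 1F 3F
  pick false false true  true  _ = two 2F 3F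

ends-differ : ∀ {k} (i : Fin k) → toℕ (inject₁ i) ≢ suc (toℕ i)
ends-differ i eq = ℕ.1+n≢n (trans (sym eq) (Fin.toℕ-inject₁ i))

module _ {m n : ℕ} (i : Fin m) (j : Fin n) where

  centre : Vertex
  centre = suc (toℕ i) , suc (toℕ j)

  -- In the order north, south, west, east, on which `mask` and `Balanced` rely.
  side : Fin 4 → Edge m n
  side 0F = vertical (inject₁ i) j
  side 1F = vertical (suc i) j
  side 2F = horizontal i (inject₁ j)
  side 3F = horizontal i (suc j)

  side-injective : ∀ a b → side a ≡ side b → a ≡ b
  side-injective 0F 0F _  = refl
  side-injective 1F 1F _  = refl
  side-injective 2F 2F _  = refl
  side-injective 3F 3F _  = refl
  side-injective 0F 2F ()
  side-injective 0F 3F ()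
  side-injective 1F 2F ()
  side-injective 1F 3F ()
  side-injective 0F 1F eq = contradiction (cong (proj₁ ∘ lesserEnd) eq) (ends-differ i)
  side-injective 1F 0F eq = contradiction (cong (proj₁ ∘ lesserEnd) (sym eq)) (ends-differ i)
  side-injective 2F 3F eq = contradiction (cong (proj₂ ∘ lesserEnd) eq) (ends-differ j)
  side-injective 3F 2F eq = contradiction (cong (proj₂ ∘ lesserEnd) (sym eq)) (ends-differ j)

  greaterEnd⇒side : ∀ e → greaterEnd e ≡ centre → e ≡ side 0F ⊎ e ≡ side 2F
  greaterEnd⇒side (vertical a b) eq = inj₁ (cong₂ vertical
    (Fin.toℕ-injective (trans (ℕ.suc-injective (cong proj₁ eq)) (sym (Fin.toℕ-inject₁ i))))
    (Fin.toℕ-injective (ℕ.suc-injective (cong proj₂ eq))))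
  greaterEnd⇒side (horizontal a b) eq = inj₂ (cong₂ horizontal
    (Fin.toℕ-injective (ℕ.suc-injective (cong proj₁ eq)))
    (Fin.toℕ-injective (trans (ℕ.suc-injective (cong proj₂ eq)) (sym (Fin.toℕ-inject₁ j)))))

  lesserEnd⇒side : ∀ e → lesserEnd e ≡ centre → e ≡ side 1F ⊎ e ≡ side 3F
  lesserEnd⇒side (vertical a b) eq = inj₁ (cong₂ vertical
    (Fin.toℕ-injective (cong proj₁ eq)) (Fin.toℕ-injective (ℕ.suc-injective (cong proj₂ eq))))
  lesserEnd⇒side (horizontal a b) eq = inj₂ (cong₂ horizontal
    (Fin.toℕ-injective (ℕ.suc-injective (cong proj₁ eq))) (Fin.toℕ-injective (cong proj₂ eq)))

  greaterEnd-side : ∀ a → a ≡ 0F ⊎ a ≡ 2F → greaterEnd (side a) ≡ centre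
  greaterEnd-side _ (inj₁ refl) = cong (λ x → suc x , suc (toℕ j)) (Fin.toℕ-inject₁ i)
  greaterEnd-side _ (inj₂ refl) = cong (λ x → suc (toℕ i) , suc x) (Fin.toℕ-inject₁ j)

  incident⇒side : ∀ e → e IncidentTo centre → ∃ λ a → e ≡ side a
  incident⇒side e (inj₁ eq) = case lesserEnd⇒side e eq of λ where
    (inj₁ e≡) → 1F , e≡
    (inj₂ e≡) → 3F , e≡
  incident⇒side e (inj₂ eq) = case greaterEnd⇒side e eq of λ where
    (inj₁ e≡) → 0F , e≡
    (inj₂ e≡) → 2F , e≡

  side-incident : ∀ a → side a IncidentTo centre
  side-incident 0F = inj₂ (greaterEnd-side 0F (inj₁ refl))
  side-incident 1F = inj₁ refl
  side-incident 2F = inj₂ (greaterEnd-side 2F (inj₂ refl))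
  side-incident 3F = inj₁ refl

  -- The edges for which `Q` can hold are among the four sides, which are distinct, so a condition
  -- on the whole graph comes down to four bits.
  exactlyTwo⇔count : ∀ (Q : Edge m n → Set) q → (∀ e → Q e → e IncidentTo centre) →
    (∀ a → Q (side a) ⇔ T (q a)) → ExactlyTwo Q ⇔ (count q ≡ 2)
  exactlyTwo⇔count Q q incident Q⇔q = mk⇔
    (λ two → exactlyTwo⇒count q (ExactlyTwo-resp Q⇔q (restrict two)))
    (λ eq → extend
      (ExactlyTwo-resp (λ a → mk⇔ (from (Q⇔q a)) (to (Q⇔q a))) (count⇒exactlyTwo q eq)))
    where
    restrict : ExactlyTwo Q → ExactlyTwo (Q ∘ side)
    restrict (x , y , x≢y , Qx , Qy , only)
      with incident⇒side x (incident x Qx) | incident⇒side y (incident y Qy)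
    ... | a , refl | b , refl = a , b , (λ { refl → x≢y refl }) , Qx , Qy , λ c Qc →
      case only (side c) Qc of λ where
        (inj₁ eq) → inj₁ (side-injective c a eq)
        (inj₂ eq) → inj₂ (side-injective c b eq)
    extend : ExactlyTwo (Q ∘ side) → ExactlyTwo Q
    extend (a , b , a≢b , Qa , Qb , only) =
      side a , side b , (λ eq → a≢b (side-injective a b eq)) , Qa , Qb , only′
      where
      only′ : ∀ e → Q e → e ≡ side a ⊎ e ≡ side b
      only′ e Qe with incident⇒side e (incident e Qe)
      ... | c , refl = case only c Qe of λ where
        (inj₁ refl) → inj₁ refl
        (inj₂ refl) → inj₂ refl

  centre-interior : Interior m n centre
  centre-interior = (s≤s z≤n , Fin.toℕ<n i) , (s≤s z≤n , Fin.toℕ<n j)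

interior⇒centre : ∀ {m n} v → Interior m n v → ∃₂ λ (i : Fin m) (j : Fin n) → v ≡ centre i j
interior⇒centre (suc a , suc b) ((_ , a<m) , (_ , b<n)) =
  fromℕ< a<m , fromℕ< b<n ,
  sym (cong₂ (λ x y → suc x , suc y) (Fin.toℕ-fromℕ< a<m) (Fin.toℕ-fromℕ< b<n))

interior-∀ : ∀ {m n} (Q : Vertex → Set) → (∀ (i : Fin m) (j : Fin n) → Q (centre i j)) →
  ∀ v → Interior m n v → Q v
interior-∀ Q h v v-interior with interior⇒centre v v-interior
... | i , j , refl = h i j

-- A degree condition around a vertex is the balance of the increments x, once
-- the increments are complemented on two of the four sides: in-degree for p = true
-- and out-degree for p = false; for loops, p depends on the parity of the vertex.

mask : Bool → Fin 4 → Bool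
mask p 0F = not p
mask p 1F = p
mask p 2F = p
mask p 3F = not p

Balanced : (Fin 4 → Bool) → Set
Balanced x = bit (x 0F) + bit (x 3F) ≡ bit (x 1F) + bit (x 2F)

Balanced-resp : ∀ {x y} → (∀ a → x a ≡ y a) → Balanced x → Balanced y
Balanced-resp x≗y eq = trans (sum≡ 0F 3F) (trans eq (sym (sum≡ 1F 2F)))
  where
  sum≡ = λ a b → sym (cong₂ (λ c d → bit c + bit d) (x≗y a) (x≗y b))

-- Complementing both bits on one side of the balance turns their sum s into 2 - s, so the total is
-- 2 exactly when the two sums agree.
balanced⇔count : ∀ p x → Balanced x ⇔ (count (λ a → x a xor mask p a) ≡ 2)
balanced⇔count p x = mk⇔ (⇒ p (x 0F) (x 1F) (x 2F) (x 3F)) (⇐ p (x 0F) (x 1F) (x 2F) (x 3F))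
  where
  degree : (p a b c d : Bool) → ℕ
  degree p a b c d = bit (a xor not p) + bit (b xor p) + bit (c xor p) + bit (d xor not p)
  ⇒ : ∀ p a b c d → bit a + bit d ≡ bit b + bit c → degree p a b c d ≡ 2
  ⇒ = from-yes (∀Bool? λ p → ∀Bool? λ a → ∀Bool? λ b → ∀Bool? λ c → ∀Bool? λ d →
    (bit a + bit d ℕ.≟ bit b + bit c) →-dec (degree p a b c d ℕ.≟ 2))
  ⇐ : ∀ p a b c d → degree p a b c d ≡ 2 → bit a + bit d ≡ bit b + bit c
  ⇐ = from-yes (∀Bool? λ p → ∀Bool? λ a → ∀Bool? λ b → ∀Bool? λ c → ∀Bool? λ d →
    (degree p a b c d ℕ.≟ 2) →-dec (bit a + bit d ℕ.≟ bit b + bit c))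

T-not⇒≡ : ∀ {x} → T (not x) → x ≡ false
T-not⇒≡ {false} _ = refl

xor-cancelʳ : ∀ x y → (x xor y) xor y ≡ x
xor-cancelʳ x y = trans (xor-assoc x y y) (trans (cong (x xor_) (xor-same y)) (xor-identityʳ x))

xor-injectiveˡ : ∀ {x y} z → x xor z ≡ y xor z → x ≡ y
xor-injectiveˡ {x} {y} z eq =
  trans (sym (xor-cancelʳ x z)) (trans (cong (_xor z) eq) (xor-cancelʳ y z))

-- Ice configurations

isGreater : Direction → Bool
isGreater toLesser  = false
isGreater toGreater = true

direction : Bool → Direction
direction false = toLesser
direction true  = toGreater

isGreater-injective : ∀ {d d′} → isGreater d ≡ isGreater d′ → d ≡ d′
isGreater-injective {toLesser}  {toLesser}  _ = refl
isGreater-injective {toGreater} {toGreater} _ = refl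

isGreater-direction : ∀ b → isGreater (direction b) ≡ b
isGreater-direction false = refl
isGreater-direction true  = refl

module _ {m n : ℕ} where

  open Increments

  lesser≢greater : ∀ (e : Edge m n) → lesserEnd e ≢ greaterEnd e
  lesser≢greater (vertical _ _)   = ℕ.1+n≢n ∘ sym ∘ cong proj₁
  lesser≢greater (horizontal _ _) = ℕ.1+n≢n ∘ sym ∘ cong proj₂

  -- `f` is the asserted bit as a function of the direction of `e`. Its two values are hypotheses,
  -- so that the same four lemmas serve every side, every mask and the boundary.
  module _ (o : Orientation m n) (e : Edge m n) {v : Vertex} (f : Bool → Bool) where

    target-greater : f false ≡ false → f true ≡ true → greaterEnd e ≡ v →
      (target o e ≡ v) ⇔ T (f (isGreater (o e)))
    target-greater f₀ f₁ refl with o e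
    ... | toLesser  rewrite f₀ = mk⇔ (lesser≢greater e) (λ ())
    ... | toGreater rewrite f₁ = mk⇔ _ (λ _ → refl)

    target-lesser : f false ≡ true → f true ≡ false → lesserEnd e ≡ v →
      (target o e ≡ v) ⇔ T (f (isGreater (o e)))
    target-lesser f₀ f₁ refl with o e
    ... | toLesser  rewrite f₀ = mk⇔ _ (λ _ → refl)
    ... | toGreater rewrite f₁ = mk⇔ (lesser≢greater e ∘ sym) (λ ())

    source-greater : f false ≡ true → f true ≡ false → greaterEnd e ≡ v →
      (source o e ≡ v) ⇔ T (f (isGreater (o e)))
    source-greater f₀ f₁ refl with o e
    ... | toLesser  rewrite f₀ = mk⇔ _ (λ _ → refl)
    ... | toGreater rewrite f₁ = mk⇔ (lesser≢greater e) (λ ())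

    source-lesser : f false ≡ false → f true ≡ true → lesserEnd e ≡ v →
      (source o e ≡ v) ⇔ T (f (isGreater (o e)))
    source-lesser f₀ f₁ refl with o e
    ... | toLesser  rewrite f₀ = mk⇔ (lesser≢greater e ∘ sym) (λ ())
    ... | toGreater rewrite f₁ = mk⇔ _ (λ _ → refl)

  module _ (o : Orientation m n) (e : Edge m n) {v : Vertex} where

    target-incident : target o e ≡ v → e IncidentTo v
    target-incident eq with o e
    ... | toLesser  = inj₁ eq
    ... | toGreater = inj₂ eq

    source-incident : source o e ≡ v → e IncidentTo v
    source-incident eq with o e
    ... | toLesser  = inj₂ eq
    ... | toGreater = inj₁ eq

  isHorizontal : Edge m n → Bool
  isHorizontal (vertical _ _)   = false
  isHorizontal (horizontal _ _) = true

  -- A unit runs down a vertical edge and leftwards along a horizontal one. The prescribed arrows,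
  -- upwards at the top and rightwards on the left, give 0.
  iceIncrement : Orientation m n → Edge m n → Bool
  iceIncrement o e = isGreater (o e) xor isHorizontal e

  module _ (o : Orientation m n) (i : Fin m) (j : Fin n) where

    private
      x : Fin 4 → Bool
      x = iceIncrement o ∘ side i j

    target-side : ∀ a → (target o (side i j a) ≡ centre i j) ⇔ T (x a xor mask true a)
    target-side 0F = target-greater o (side i j 0F) (λ g → (g xor false) xor false) refl refl
      (greaterEnd-side i j 0F (inj₁ refl))
    target-side 1F = target-lesser o (side i j 1F) (λ g → (g xor false) xor true) refl refl refl
    target-side 2F = target-greater o (side i j 2F) (λ g → (g xor true) xor true) refl refl
      (greaterEnd-side i j 2F (inj₂ refl))
    target-side 3F = target-lesser o (side i j 3F) (λ g → (g xor true) xor false) refl refl refl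

    source-side : ∀ a → (source o (side i j a) ≡ centre i j) ⇔ T (x a xor mask false a)
    source-side 0F = source-greater o (side i j 0F) (λ g → (g xor false) xor true) refl refl
      (greaterEnd-side i j 0F (inj₁ refl))
    source-side 1F = source-lesser o (side i j 1F) (λ g → (g xor false) xor false) refl refl refl
    source-side 2F = source-greater o (side i j 2F) (λ g → (g xor true) xor false) refl refl
      (greaterEnd-side i j 2F (inj₂ refl))
    source-side 3F = source-lesser o (side i j 3F) (λ g → (g xor true) xor true) refl refl refl

    in-degree⇔balanced : ExactlyTwo (λ e → target o e ≡ centre i j) ⇔ Balanced x
    in-degree⇔balanced =
      mk⇔ (from (balanced⇔count true x) ∘ to two) (from two ∘ to (balanced⇔count true x))
      where
      two = exactlyTwo⇔count i j _ (λ a → x a xor mask true a) (λ e → target-incident o e)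
        target-side

    out-degree⇔balanced : ExactlyTwo (λ e → source o e ≡ centre i j) ⇔ Balanced x
    out-degree⇔balanced =
      mk⇔ (from (balanced⇔count false x) ∘ to two) (from two ∘ to (balanced⇔count false x))
      where
      two = exactlyTwo⇔count i j _ (λ a → x a xor mask false a) (λ e → source-incident o e)
        source-side

  ice⇒increments : RectangularIce m n → Increments m n
  ice⇒increments I = record
    { increment = iceIncrement orientation
    ; top       = λ j → T-not⇒≡ (to (target-lesser orientation (vertical zero j)
        (λ g → not (g xor false)) refl refl refl) (top-outward j))
    ; left      = λ i → T-not⇒≡ (to (target-greater orientation (horizontal i zero)
        (λ g → not (g xor true)) refl refl refl) (left-inward i))
    ; balance   = λ i j →
        to (in-degree⇔balanced orientation i j) (in-degree _ (centre-interior i j))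
    }
    where open RectangularIce I

  increments⇒ice : (X : Increments m n) →
    ∃ λ (I : RectangularIce m n) → ∀ e → iceIncrement (RectangularIce.orientation I) e ≡
      increment X e
  increments⇒ice X = record
    { orientation = o
    ; left-inward = λ i → from (target-greater o (horizontal i zero)
        (λ g → not (g xor true)) refl refl refl)
          (subst (T ∘ not) (sym (trans (o-increment (horizontal i zero)) (left X i))) _)
    ; top-outward = λ j → from (target-lesser o (vertical zero j)
        (λ g → not (g xor false)) refl refl refl)
          (subst (T ∘ not) (sym (trans (o-increment (vertical zero j)) (top X j))) _)
    -- The same balance gives both degrees, through the two values of the mask.
    ; in-degree   = interior-∀ _ λ i j → from (in-degree⇔balanced o i j) (o-balanced i j)
    ; out-degree  = interior-∀ _ λ i j → from (out-degree⇔balanced o i j) (o-balanced i j)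
    } , o-increment
    where
    o : Orientation m n
    o e = direction (increment X e xor isHorizontal e)
    o-increment : ∀ e → iceIncrement o e ≡ increment X e
    o-increment e =
      trans (cong (_xor isHorizontal e) (isGreater-direction (increment X e xor isHorizontal e)))
      (xor-cancelʳ (increment X e) (isHorizontal e))
    o-balanced : ∀ i j → Balanced (iceIncrement o ∘ side i j)
    o-balanced i j = Balanced-resp (sym ∘ o-increment ∘ side i j) (balance X i j)

ice↔increments : ∀ m n → Bijection (rectangularIces m n) (increments m n)
ice↔increments m n = bijection ice⇒increments
  (λ I≈I′ e → cong (λ d → isGreater d xor isHorizontal e) (I≈I′ e))
  (λ eq e → isGreater-injective (xor-injectiveˡ (isHorizontal e) (eq e)))
  increments⇒ice

-- Fully-packed loops

odd : ℕ → Bool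
odd zero    = false
odd (suc k) = not (odd k)

even⇒2∣ : ∀ k → T (not (odd k)) → 2 ∣ k
odd⇒2∣suc : ∀ k → T (odd k) → 2 ∣ suc k
even⇒2∣ zero    _ = divides 0 refl
even⇒2∣ (suc k) t = odd⇒2∣suc k (subst T (not-involutive (odd k)) t)
odd⇒2∣suc (suc k) t = ∣m∣n⇒∣m+n (divides 1 refl) (even⇒2∣ k t)

odd⇔ : ∀ k → T (odd k) ⇔ Odd k
odd⇔ k = mk⇔ odd⇒ ⇒odd
  where
  odd⇒ : T (odd k) → Odd k
  odd⇒ t 2∣k with () ← ∣1⇒≡1 (∣m+n∣m⇒∣n (subst (2 ∣_) (ℕ.+-comm 1 k) (odd⇒2∣suc k t)) 2∣k)
  ⇒odd : Odd k → T (odd k)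
  ⇒odd 2∤k with odd k in eq
  ... | true  = _
  ... | false = 2∤k (even⇒2∣ k (subst (T ∘ not) (sym eq) _))

even⇔ : ∀ k → T (not (odd k)) ⇔ Even k
even⇔ k = mk⇔ (even⇒2∣ k) ⇒even
  where
  ⇒even : Even k → T (not (odd k))
  ⇒even 2∣k with odd k in eq
  ... | false = _
  ... | true  = to (odd⇔ k) (subst T (sym eq) _) 2∣k

module _ {m n : ℕ} where

  open Increments

  -- The loop configuration of zero increments. It has the prescribed edges at the top and on the
  -- left, and it contains the south and west sides of each odd interior vertex and the north and
  -- east sides of each even one, as `mask` requires.
  flip : Edge m n → Bool
  flip (vertical i j)   = odd (toℕ i + suc (toℕ j))
  flip (horizontal i j) = not (odd (suc (toℕ i) + toℕ j))

  flip-side : ∀ i j a → flip (side i j a) ≡ mask (odd (toℕ i + toℕ j)) a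
  flip-side i j 0F rewrite Fin.toℕ-inject₁ i = cong odd (ℕ.+-suc (toℕ i) (toℕ j))
  flip-side i j 1F rewrite ℕ.+-suc (toℕ i) (toℕ j) = not-involutive _
  flip-side i j 2F rewrite Fin.toℕ-inject₁ j = not-involutive _
  flip-side i j 3F rewrite ℕ.+-suc (toℕ i) (toℕ j) = cong not (not-involutive _)

  flip-left : ∀ i → T (flip (horizontal i zero)) ⇔ Even (suc (toℕ i))
  flip-left i rewrite ℕ.+-identityʳ (toℕ i) = even⇔ (suc (toℕ i))

  fplIncrement : (Edge m n → Bool) → Edge m n → Bool
  fplIncrement present e = present e xor flip e

  degree⇔balanced : ∀ present i j →
    ExactlyTwo (λ e → (e IncidentTo centre i j) × T (present e)) ⇔
      Balanced (fplIncrement present ∘ side i j)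
  degree⇔balanced present i j =
    mk⇔ (from (balanced⇔count p x) ∘ to two) (from two ∘ to (balanced⇔count p x))
    where
    p : Bool
    p = odd (toℕ i + toℕ j)
    x : Fin 4 → Bool
    x = fplIncrement present ∘ side i j
    unmask : ∀ a → x a xor mask p a ≡ present (side i j a)
    unmask a = trans (cong (x a xor_) (sym (flip-side i j a)))
      (xor-cancelʳ (present (side i j a)) _)
    two = exactlyTwo⇔count i j _ (λ a → x a xor mask p a) (λ _ → proj₁)
      λ a → mk⇔ (subst T (sym (unmask a)) ∘ proj₂)
        (λ t → side-incident i j a , subst T (unmask a) t)

  fpl⇒increments : PartialFPL m n → Increments m n
  fpl⇒increments L = record
    { increment = fplIncrement present
    ; top       = λ j → matches (vertical zero j) (odd⇔ _) (top-boundary j)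
    ; left      = λ i → matches (horizontal i zero) (flip-left i) (left-boundary i)
    ; balance   = λ i j → to (degree⇔balanced present i j) (interior-degree _ (centre-interior i j))
    }
    where
    open PartialFPL L
    matches : ∀ e {Q : Set} → T (flip e) ⇔ Q → T (present e) ⇔ Q → fplIncrement present e ≡ false
    matches e flip⇔ present⇔ = trans
      (cong (_xor flip e) (T⇔⇒≡ (from flip⇔ ∘ to present⇔) (from present⇔ ∘ to flip⇔)))
        (xor-same (flip e))

  increments⇒fpl : (X : Increments m n) →
    ∃ λ (L : PartialFPL m n) → ∀ e → fplIncrement (PartialFPL.present L) e ≡ increment X e
  increments⇒fpl X = record
    { present         = present
    ; interior-degree = interior-∀ _ λ i j → from (degree⇔balanced present i j)
        (Balanced-resp (sym ∘ present-increment ∘ side i j) (balance X i j))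
    ; top-boundary    = λ j → ⇔-trans (matches (vertical zero j) (top X j)) (odd⇔ _)
    ; left-boundary   = λ i → ⇔-trans (matches (horizontal i zero) (left X i)) (flip-left i)
    } , present-increment
    where
    present : Edge m n → Bool
    present e = increment X e xor flip e
    present-increment : ∀ e → fplIncrement present e ≡ increment X e
    present-increment e = xor-cancelʳ (increment X e) (flip e)
    matches : ∀ e → increment X e ≡ false → T (present e) ⇔ T (flip e)
    matches e eq rewrite eq = mk⇔ id id

fpl↔increments : ∀ m n → Bijection (partialFPLs m n) (increments m n)
fpl↔increments m n = bijection fpl⇒increments
  (λ L≈L′ e → cong (_xor flip e) (L≈L′ e))
  (λ eq e → xor-injectiveˡ (flip e) (eq e))
  increments⇒fpl

-- Corner sums and height functions

∑< : ∀ {k} → (Fin k → ℕ) → Fin (suc k) → ℕ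
∑< f zero            = 0
∑< {suc k} f (suc i) = f zero + ∑< (f ∘ suc) i

∑<-suc : ∀ {k} (f : Fin k → ℕ) i → ∑< f (suc i) ≡ ∑< f (inject₁ i) + f i
∑<-suc f zero    = ℕ.+-comm (f zero) 0
∑<-suc f (suc i) = trans (cong (f zero +_) (∑<-suc (f ∘ suc) i)) (sym (ℕ.+-assoc (f zero) _ _))

-- Adds up the unit squares between two neighbouring lines: `f` and `f′` are increments along the
-- lines, `g` those across, which start at 0.
telescope : ∀ {k} (f f′ : Fin k → ℕ) (g : Fin (suc k) → ℕ) → g zero ≡ 0 →
  (∀ i → f i + g (inject₁ i) ≡ f′ i + g (suc i)) → ∀ i → ∑< f i ≡ ∑< f′ i + g i
telescope f f′ g g₀ step = <-weakInduction _ (sym g₀) λ i ih → begin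
  ∑< f (suc i)                                ≡⟨ ∑<-suc f i ⟩
  ∑< f (inject₁ i) + f i                      ≡⟨ cong (_+ f i) ih ⟩
  ∑< f′ (inject₁ i) + g (inject₁ i) + f i     ≡⟨ swap (∑< f′ (inject₁ i)) _ _ ⟩
  ∑< f′ (inject₁ i) + (f i + g (inject₁ i))   ≡⟨ cong (∑< f′ (inject₁ i) +_) (step i) ⟩
  ∑< f′ (inject₁ i) + (f′ i + g (suc i))      ≡⟨ ℕ.+-assoc (∑< f′ (inject₁ i)) _ _ ⟨
  ∑< f′ (inject₁ i) + f′ i + g (suc i)        ≡⟨ cong (_+ g (suc i)) (∑<-suc f′ i) ⟨
  ∑< f′ (suc i) + g (suc i)                   ∎
  where
  open ≡-Reasoning
  swap : ∀ a b c → a + b + c ≡ a + (c + b)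
  swap = solve-∀

∑<-replicate : ∀ {k} c (f : Fin k → ℕ) → (∀ i → f i ≡ c) → ∀ i → ∑< f i ≡ toℕ i * c
∑<-replicate c f f≡c zero            = refl
∑<-replicate {suc k} c f f≡c (suc i) = cong₂ _+_ (f≡c zero) (∑<-replicate c (f ∘ suc) (f≡c ∘ suc) i)

record CornerSum (m n : ℕ) : Set where
  field
    corner      : Fin (suc m) → Fin (suc n) → ℕ
    top         : ∀ j → corner zero j ≡ 0
    left        : ∀ i → corner i zero ≡ 0
    grows-down  : ∀ i j → corner (inject₁ i) j ≤ corner (suc i) j ×
      corner (suc i) j ≤ suc (corner (inject₁ i) j)
    grows-right : ∀ i j → corner i (inject₁ j) ≤ corner i (suc j) ×
      corner i (suc j) ≤ suc (corner i (inject₁ j))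

cornerSums : ℕ → ℕ → Setoid 0ℓ 0ℓ
cornerSums m n = pointwise {CornerSum m n} λ D → uncurry (CornerSum.corner D)

grow : ∀ {a b} → (a ≤ b) × (b ≤ suc a) → b ≡ a + bit (a <ᵇ b)
grow {zero}  {zero}        _               = refl
grow {zero}  {suc zero}    _               = refl
grow {zero}  {suc (suc b)} (_ , s≤s ())
grow {suc a} {suc b}       (s≤s p , s≤s q) = cong suc (grow (p , q))

<ᵇ-bit : ∀ a x → (a <ᵇ a + bit x) ≡ x
<ᵇ-bit zero    false = refl
<ᵇ-bit zero    true  = refl
<ᵇ-bit (suc a) x     = <ᵇ-bit a x

bit-bounds : ∀ a x → (a ≤ a + bit x) × (a + bit x ≤ suc a)
bit-bounds a x = ℕ.m≤m+n a (bit x) ,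
  ℕ.≤-trans (ℕ.+-monoʳ-≤ a (bit≤1 x)) (ℕ.≤-reflexive (ℕ.+-comm a 1))

module _ {m n : ℕ} where

  cornerIncrement : (Fin (suc m) → Fin (suc n) → ℕ) → Edge m n → Bool
  cornerIncrement D (vertical i j)   = D i (inject₁ j) <ᵇ D i (suc j)
  cornerIncrement D (horizontal i j) = D (inject₁ i) j <ᵇ D (suc i) j

  cornerSum⇒increments : CornerSum m n → Increments m n
  cornerSum⇒increments C = record
    { increment = cornerIncrement corner
    ; top       = λ j → cong₂ _<ᵇ_ (top (inject₁ j)) (top (suc j))
    ; left      = λ i → cong₂ _<ᵇ_ (left (inject₁ i)) (left (suc i))
    ; balance   = λ i j →
        let a = corner (inject₁ i) (inject₁ j); b = corner (inject₁ i) (suc j)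
            c = corner (suc i) (inject₁ j);     d = corner (suc i) (suc j)
        in ℕ.+-cancelˡ-≡ a _ _ (trans
          (sym (square a (bit (a <ᵇ b)) (grow (grows-right (inject₁ i) j))
            (grow (grows-down i (suc j)))))
          (trans (square a (bit (a <ᵇ c)) (grow (grows-down i (inject₁ j)))
            (grow (grows-right (suc i) j)))
                 (cong (a +_) (ℕ.+-comm (bit (a <ᵇ c)) _))))
    }
    where
    open CornerSum C
    square : ∀ a x {b d y} → b ≡ a + x → d ≡ b + y → d ≡ a + (x + y)
    square a x refl refl = ℕ.+-assoc a _ _

  cornerSum-injective : ∀ (C C′ : CornerSum m n) → let open CornerSum in
    (∀ e → cornerIncrement (corner C) e ≡ cornerIncrement (corner C′) e) → ∀ i j →
      corner C i j ≡ corner C′ i j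
  cornerSum-injective C C′ eq i j = <-weakInduction (λ i → corner C i j ≡ corner C′ i j)
    (trans (top C j) (sym (top C′ j)))
    (λ i ih → trans (grow (grows-down C i j)) (trans
      (cong₂ _+_ ih (cong bit (eq (horizontal i j)))) (sym (grow (grows-down C′ i j))))) i
    where open CornerSum

  module _ (X : Increments m n) where

    open Increments X

    cornerOf : Fin (suc m) → Fin (suc n) → ℕ
    cornerOf i = ∑< λ j → bit (increment (vertical i j))

    cornerOf-horizontal : ∀ i j →
      cornerOf i (suc j) ≡ cornerOf i (inject₁ j) + bit (increment (vertical i j))
    cornerOf-horizontal i = ∑<-suc _

    -- `cornerOf` sums along rows only. That it also grows correctly down the columns is the content
    -- of the balance, telescoped from the left border.
    cornerOf-vertical : ∀ i j →
      cornerOf (suc i) j ≡ cornerOf (inject₁ i) j + bit (increment (horizontal i j))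
    cornerOf-vertical i = telescope _ _ (λ j → bit (increment (horizontal i j))) (cong bit (left i))
      (λ j → sym (balance i j))

    increments⇒cornerSum : ∃ λ (C : CornerSum m n) → ∀ e → cornerIncrement (CornerSum.corner C) e ≡
      increment e
    increments⇒cornerSum = record
      { corner     = cornerOf
      ; top        = λ j → trans (∑<-replicate 0 _ (cong bit ∘ top) j) (ℕ.*-zeroʳ (toℕ j))
      ; left       = λ _ → refl
      ; grows-down  = λ i j →
          subst (λ b → (cornerOf (inject₁ i) j ≤ b) × (b ≤ suc (cornerOf (inject₁ i) j)))
          (sym (cornerOf-vertical i j)) (bit-bounds _ _)
      ; grows-right = λ i j →
          subst (λ b → (cornerOf i (inject₁ j) ≤ b) × (b ≤ suc (cornerOf i (inject₁ j))))
          (sym (cornerOf-horizontal i j)) (bit-bounds _ _)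
      } , λ where
        (vertical i j)   → trans (cong (cornerOf i (inject₁ j) <ᵇ_) (cornerOf-horizontal i j))
          (<ᵇ-bit (cornerOf i (inject₁ j)) _)
        (horizontal i j) → trans (cong (cornerOf (inject₁ i) j <ᵇ_) (cornerOf-vertical i j))
          (<ᵇ-bit (cornerOf (inject₁ i) j) _)

cornerSum↔increments : ∀ m n → Bijection (cornerSums m n) (increments m n)
cornerSum↔increments m n = bijection cornerSum⇒increments
  (λ where
    C≈C′ (vertical i j)   → cong₂ _<ᵇ_ (C≈C′ _) (C≈C′ _)
    C≈C′ (horizontal i j) → cong₂ _<ᵇ_ (C≈C′ _) (C≈C′ _))
  (λ {C} {C′} eq → uncurry (cornerSum-injective C C′ eq))
  increments⇒cornerSum

-- h i j = i + j − 2 D i j, so h drops exactly where D grows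

drop : ∀ {a b} → ∣ a - b ∣ ≡ 1 → b + 2 * bit (b <ᵇ a) ≡ suc a
drop {zero}     {suc zero}    _  = refl
drop {suc zero} {zero}        _  = refl
drop {suc a}    {suc b}       eq = cong suc (drop eq)

drop⇒adjacent : ∀ {a b} x → b + 2 * bit x ≡ suc a → ∣ a - b ∣ ≡ 1
drop⇒adjacent {zero}  {zero}        false ()
drop⇒adjacent {zero}  {zero}        true  ()
drop⇒adjacent {zero}  {suc zero}    _     _  = refl
drop⇒adjacent {suc a} {zero}        true  eq = sym (ℕ.suc-injective eq)
drop⇒adjacent {suc a} {suc b}       x     eq = drop⇒adjacent {a} x (ℕ.suc-injective eq)

module _ {m n : ℕ} where

  heightIncrement : (Fin (suc m) → Fin (suc n) → ℕ) → Edge m n → Bool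
  heightIncrement h (vertical i j)   = h i (suc j) <ᵇ h i (inject₁ j)
  heightIncrement h (horizontal i j) = h (suc i) j <ᵇ h (inject₁ i) j

  module _ (H : PartialHeightFunction m n) where

    open PartialHeightFunction H

    drop-vertical : ∀ i j → h (suc i) j + 2 * bit (heightIncrement h (horizontal i j)) ≡
      suc (h (inject₁ i) j)
    drop-vertical i j =
      drop {h (inject₁ i) j}
      (vertically-adjacent (inject₁ i) (suc i) j (cong suc (sym (Fin.toℕ-inject₁ i))))

    drop-horizontal : ∀ i j → h i (suc j) + 2 * bit (heightIncrement h (vertical i j)) ≡
      suc (h i (inject₁ j))
    drop-horizontal i j =
      drop {h i (inject₁ j)}
      (horizontally-adjacent i (inject₁ j) (suc j) (cong suc (sym (Fin.toℕ-inject₁ j))))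

    height⇒increments : Increments m n
    height⇒increments = record
      { increment = heightIncrement h
      ; top       = λ j → trans (cong₂ _<ᵇ_ (top-boundary (suc j)) (top-boundary (inject₁ j)))
          (1+n≮n j)
      ; left      = λ i → trans (cong₂ _<ᵇ_ (left-boundary (suc i)) (left-boundary (inject₁ i)))
          (1+n≮n i)
      ; balance   = λ i j → square (h (suc i) (suc j))
          (bit (heightIncrement h (vertical (inject₁ i) j)))
            (bit (heightIncrement h (horizontal i (suc j))))
          (bit (heightIncrement h (horizontal i (inject₁ j))))
            (bit (heightIncrement h (vertical (suc i) j)))
          (drop-horizontal (inject₁ i) j) (drop-vertical i (suc j))
          (drop-vertical i (inject₁ j)) (drop-horizontal (suc i) j)
      }
      where
      1+n≮n : ∀ {k} (i : Fin k) → (suc (toℕ i) <ᵇ toℕ (inject₁ i)) ≡ false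
      1+n≮n zero    = refl
      1+n≮n (suc i) = 1+n≮n i
      regroup : ∀ d y x → d + 2 * y + 2 * x ≡ 2 * (x + y) + d
      regroup = solve-∀
      corner-to-corner : ∀ {a b} d x y → b + 2 * x ≡ suc a → d + 2 * y ≡ suc b →
        2 * (x + y) + d ≡ suc (suc a)
      corner-to-corner d x y p q =
        trans (sym (regroup d y x)) (trans (cong (_+ 2 * x) q) (cong suc p))
      square : ∀ {a b c} d x y z w → b + 2 * x ≡ suc a → d + 2 * y ≡ suc b →
        c + 2 * z ≡ suc a → d + 2 * w ≡ suc c → x + y ≡ w + z
      -- Both ways around the square arrive at `suc (suc a)`; the common `d` and the factor 2
      -- cancel.
      square d x y z w p q r s = trans (ℕ.*-cancelˡ-≡ (x + y) (z + w) 2 (ℕ.+-cancelʳ-≡ d _ _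
        (trans (corner-to-corner d x y p q) (sym (corner-to-corner d z w r s))))) (ℕ.+-comm z w)

  height-injective : ∀ (H H′ : PartialHeightFunction m n) → let open PartialHeightFunction in
    (∀ e → heightIncrement (h H) e ≡ heightIncrement (h H′) e) → ∀ i j → h H i j ≡ h H′ i j
  height-injective H H′ eq i j = <-weakInduction (λ i → h H i j ≡ h H′ i j)
    (trans (top-boundary H j) (sym (top-boundary H′ j)))
    (λ i ih → ℕ.+-cancelʳ-≡ (2 * bit (heightIncrement (h H) (horizontal i j))) _ _
      (trans (drop-vertical H i j) (trans
      (cong suc ih)
        (trans (sym (drop-vertical H′ i j))
        (cong (λ x → h H′ (suc i) j + 2 * bit x) (sym (eq (horizontal i j)))))))) i
    where open PartialHeightFunction

  module _ (X : Increments m n) where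

    open Increments X

    private
      V̄ : Fin (suc m) → Fin n → ℕ
      V̄ i j = bit (not (increment (vertical i j)))
      H̄ : Fin (suc n) → Fin m → ℕ
      H̄ j i = bit (not (increment (horizontal i j)))

    -- (i − D i j) + (j − D i j), which avoids subtraction

    heightOf : Fin (suc m) → Fin (suc n) → ℕ
    heightOf i j = ∑< (V̄ i) j + ∑< (H̄ j) i

    -- The complemented bits of row i sum to j - D i j, which loses going down what D gains. The
    -- balance of the complemented bits is again a telescoping relation.
    V̄-sum : ∀ i j → ∑< (V̄ (inject₁ i)) j ≡ ∑< (V̄ (suc i)) j + bit (increment (horizontal i j))
    V̄-sum i = telescope _ _ (λ j → bit (increment (horizontal i j))) (cong bit (left i)) λ j →
      negate (increment (vertical (inject₁ i) j)) (increment (vertical (suc i) j))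
        (increment (horizontal i (inject₁ j))) (increment (horizontal i (suc j))) (balance i j)
      where
      negate : ∀ a b c d → bit a + bit d ≡ bit b + bit c → bit (not a) + bit c ≡ bit (not b) + bit d
      negate = from-yes (∀Bool? λ a → ∀Bool? λ b → ∀Bool? λ c → ∀Bool? λ d →
        (bit a + bit d ℕ.≟ bit b + bit c) →-dec (bit (not a) + bit c ℕ.≟ bit (not b) + bit d))

    H̄-sum : ∀ i j → ∑< (H̄ (inject₁ j)) i ≡ ∑< (H̄ (suc j)) i + bit (increment (vertical i j))
    H̄-sum i j = telescope _ _ (λ i → bit (increment (vertical i j))) (cong bit (top j)) (λ i →
      negate (increment (vertical (inject₁ i) j)) (increment (vertical (suc i) j))
        (increment (horizontal i (inject₁ j))) (increment (horizontal i (suc j))) (balance i j)) i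
      where
      negate : ∀ a b c d → bit a + bit d ≡ bit b + bit c → bit (not c) + bit a ≡ bit (not d) + bit b
      negate = from-yes (∀Bool? λ a → ∀Bool? λ b → ∀Bool? λ c → ∀Bool? λ d →
        (bit a + bit d ℕ.≟ bit b + bit c) →-dec (bit (not c) + bit a ℕ.≟ bit (not d) + bit b))

    not+bit : ∀ x → bit (not x) + bit x ≡ 1
    not+bit false = refl
    not+bit true  = refl

    -- For an increment x, one summand gains 1 - x and the other loses x, so the height changes by 1
    -- - 2x.
    heightOf-horizontal : ∀ i j → heightOf i (suc j) + 2 * bit (increment (vertical i j)) ≡
      suc (heightOf i (inject₁ j))
    heightOf-horizontal i j rewrite ∑<-suc (V̄ i) j | H̄-sum i j =
      trans (regroup (∑< (V̄ i) (inject₁ j)) (V̄ i j) _ (bit (increment (vertical i j))))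
        (cong (_+ (∑< (V̄ i) (inject₁ j) + (∑< (H̄ (suc j)) i + bit (increment (vertical i j)))))
          (not+bit (increment (vertical i j))))
      where
      regroup : ∀ a v c x → a + v + c + 2 * x ≡ (v + x) + (a + (c + x))
      regroup = solve-∀

    heightOf-vertical : ∀ i j → heightOf (suc i) j + 2 * bit (increment (horizontal i j)) ≡
      suc (heightOf (inject₁ i) j)
    heightOf-vertical i j rewrite ∑<-suc (H̄ j) i | V̄-sum i j =
      trans (regroup (∑< (V̄ (suc i)) j) (H̄ j i) (∑< (H̄ j) (inject₁ i))
        (bit (increment (horizontal i j))))
        (cong (_+ (∑< (V̄ (suc i)) j + bit (increment (horizontal i j)) + ∑< (H̄ j) (inject₁ i)))
          (not+bit (increment (horizontal i j))))
      where
      regroup : ∀ a v c x → a + (c + v) + 2 * x ≡ (v + x) + (a + x + c)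
      regroup = solve-∀

    increments⇒height : ∃ λ (H : PartialHeightFunction m n) →
      ∀ e → heightIncrement (PartialHeightFunction.h H) e ≡ increment e
    increments⇒height = H , λ where
        (vertical i j)   → bit-cancel (heightOf i (suc j)) _ (increment (vertical i j))
          (trans (drop-horizontal H i j) (sym (heightOf-horizontal i j)))
        (horizontal i j) → bit-cancel (heightOf (suc i) j) _ (increment (horizontal i j))
          (trans (drop-vertical H i j) (sym (heightOf-vertical i j)))
      where
      bit-cancel : ∀ a x y → a + 2 * bit x ≡ a + 2 * bit y → x ≡ y
      bit-cancel a x y eq = bit-injective (ℕ.*-cancelˡ-≡ (bit x) (bit y) 2 (ℕ.+-cancelˡ-≡ a _ _ eq))
      H : PartialHeightFunction m n
      H = record
        { h                     = heightOf
        ; top-boundary          = λ k → trans (ℕ.+-identityʳ _)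
            (trans (∑<-replicate 1 _ (cong (bit ∘ not) ∘ top) k) (ℕ.*-identityʳ (toℕ k)))
        ; left-boundary         = λ l →
            trans (∑<-replicate 1 _ (cong (bit ∘ not) ∘ left) l) (ℕ.*-identityʳ (toℕ l))
        ; vertically-adjacent   = λ i i′ j i′≡1+i → case successor i′≡1+i of λ where
            (a , refl , refl) → drop⇒adjacent {heightOf (inject₁ a) j} (increment (horizontal a j))
              (heightOf-vertical a j)
        ; horizontally-adjacent = λ i j j′ j′≡1+j → case successor j′≡1+j of λ where
            (a , refl , refl) → drop⇒adjacent {heightOf i (inject₁ a)} (increment (vertical i a))
              (heightOf-horizontal i a)
        }

height↔increments : ∀ m n → Bijection (partialHeightFunctions m n) (increments m n)
height↔increments m n = bijection height⇒increments
  (λ where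
    H≈H′ (vertical i j)   → cong₂ _<ᵇ_ (H≈H′ _) (H≈H′ _)
    H≈H′ (horizontal i j) → cong₂ _<ᵇ_ (H≈H′ _) (H≈H′ _))
  (λ {H} {H′} eq → uncurry (height-injective H H′ eq))
  increments⇒height

-- Order ideals

InP : ℕ → ℕ → ℕ → ℕ → ℕ → Set
InP m n i j k = (k ≤ j × j < n) × (k ≤ i × i < m)

inP? : ∀ m n i j k → Dec (InP m n i j k)
inP? m n i j k = ((k ℕ.≤? j) ×-dec (j ℕ.<? n)) ×-dec ((k ℕ.≤? i) ×-dec (i ℕ.<? m))

-- Order ideals of P, extended by false to all triples of natural numbers

record Ideal (m n : ℕ) : Set where
  field
    member  : ℕ → ℕ → ℕ → Bool
    support : ∀ {i j k} → T (member i j k) → InP m n i j k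
    raise-i : ∀ {i j k} → T (member i j k) → suc i < m → T (member (suc i) j k)
    raise-j : ∀ {i j k} → T (member i j k) → suc j < n → T (member i (suc j) k)
    lower-i : ∀ {i j k} → T (member (suc i) j (suc k)) → T (member i j k)
    lower-j : ∀ {i j k} → T (member i (suc j) (suc k)) → T (member i j k)

  -- Two covers compose: `(i , j , k + 1)` lies over `(i − 1 , j , k)`, which lies over
  -- `(i , j , k)`. Hence the members over a fixed `(i , j)` are an initial segment in k, and their
  -- number determines them.
  lower-k : ∀ {i j k} → T (member i j (suc k)) → T (member i j k)
  lower-k {zero}  t with _ , () , _ ← support t
  lower-k {suc i} t = raise-i (lower-i t) (proj₂ (proj₂ (support t)))

ideals : ℕ → ℕ → Setoid 0ℓ 0ℓ
ideals m n = pointwise {Ideal m n} {ℕ × ℕ × ℕ} λ X (i , j , k) → Ideal.member X i j k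

module _ {m n : ℕ} where

  point : ∀ i j k → .(InP m n i j k) → P m n
  point i j k p = ⟨_,_,_⟩ i j k
    {ℕ.≤-<-trans (proj₁ (proj₂ p)) (proj₂ (proj₂ p))}
    {proj₁ (proj₁ p)} {proj₂ (proj₁ p)} {proj₁ (proj₂ p)} {proj₂ (proj₂ p)}

  extend : (P m n → Bool) → ∀ i j k → Dec (InP m n i j k) → Bool
  extend f i j k (yes p) = f (point i j k p)
  extend f i j k (no _)  = false

  total : (P m n → Bool) → ℕ → ℕ → ℕ → Bool
  total f i j k = extend f i j k (inP? m n i j k)

  total-in : ∀ f {i j k} (p : InP m n i j k) → total f i j k ≡ f (point i j k p)
  total-in f {i} {j} {k} p with inP? m n i j k
  ... | yes _  = refl
  ... | no p∉P = contradiction p p∉P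

  total-support : ∀ f {i j k} → T (total f i j k) → InP m n i j k
  total-support f {i} {j} {k} t with yes p ← inP? m n i j k = p

  inP : (p : P m n) → InP m n (P.i p) (P.j p) (P.k p)
  inP (⟨_,_,_⟩ i j k {_} {k≤j} {j<n} {k≤i} {i<m}) =
    -- The bounds stored in `P` are irrelevant, so a usable proof is recovered by deciding them.
    recompute (inP? m n i j k) ((k≤j , j<n) , (k≤i , i<m))

  orderIdeal⇒ideal : OrderIdeal (_≤P_ {m} {n}) → Ideal m n
  orderIdeal⇒ideal I = record
    { member  = total member
    ; support = total-support member
    ; raise-i = λ {i} {j} {k} t i<m → let (j , (k≤i , _)) = total-support member {i} {j} {k} t in
        below (j , (ℕ.m≤n⇒m≤1+n k≤i , i<m)) t (i+1 refl refl refl)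
    ; raise-j = λ {i} {j} {k} t j<n → let ((k≤j , _) , i) = total-support member {i} {j} {k} t in
        below ((ℕ.m≤n⇒m≤1+n k≤j , j<n) , i) t (j+1 refl refl refl)
    ; lower-i = λ {i} {j} {k} t → let
          ((k≤j , j<n) , (k≤i , i<m)) = total-support member {suc i} {j} {suc k} t
        in
        below ((ℕ.<⇒≤ k≤j , j<n) , (ℕ.s≤s⁻¹ k≤i , ℕ.<⇒≤ i<m)) t (i-1,k-1 refl refl refl)
    ; lower-j = λ {i} {j} {k} t → let
          ((k≤j , j<n) , (k≤i , i<m)) = total-support member {i} {suc j} {suc k} t
        in
        below ((ℕ.s≤s⁻¹ k≤j , ℕ.<⇒≤ j<n) , (ℕ.<⇒≤ k≤i , i<m)) t (j-1,k-1 refl refl refl)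
    }
    where
    open OrderIdeal I
    below : ∀ {i j k i′ j′ k′} (q : InP m n i′ j′ k′) (t : T (total member i j k)) →
      point i j k (total-support member {i} {j} {k} t) Covers point i′ j′ k′ q →
        T (total member i′ j′ k′)
    below {i} {j} {k} q t c = subst T (sym (total-in member q))
      (down-closed (subst T (total-in member (total-support member {i} {j} {k} t)) t) (c ◅ ε))

  ideal⇒orderIdeal : (X : Ideal m n) →
    ∃ λ (I : OrderIdeal (_≤P_ {m} {n})) → ∀ ((i , j , k) : ℕ × ℕ × ℕ) →
      total (OrderIdeal.member I) i j k ≡ Ideal.member X i j k
  ideal⇒orderIdeal X = record
    { member      = f
    ; down-closed = down-closed
    } , λ (i , j , k) → T⇔⇒≡
      (λ t → subst T (total-in f (total-support f {i} {j} {k} t)) t)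
      (λ t → subst T (sym (total-in f (support t))) t)
    where
    open Ideal X
    f : P m n → Bool
    f p = member (P.i p) (P.j p) (P.k p)
    step : ∀ {y z} → y Covers z → T (f y) → T (f z)
    step {z = z} (i+1 refl refl refl)     t = raise-i t (proj₂ (proj₂ (inP z)))
    step {z = z} (j+1 refl refl refl)     t = raise-j t (proj₂ (proj₁ (inP z)))
    step (i-1,k-1 refl refl refl) t = lower-i t
    step (j-1,k-1 refl refl refl) t = lower-j t
    down-closed : ∀ {y z} → T (f y) → z ≤P y → T (f z)
    down-closed t ε        = t
    down-closed t (c ◅ cs) = step c (down-closed t cs)

orderIdeal↔ideal : ∀ m n → Bijection (orderIdeals m n) (ideals m n)
orderIdeal↔ideal m n = bijection orderIdeal⇒ideal
  (λ {I} {I′} I≈I′ (i , j , k) → extend-cong I≈I′ (inP? m n i j k))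
  (λ {I} {I′} eq p → trans (sym (total-in (OrderIdeal.member I) (inP p)))
    (trans (eq (P.i p , P.j p , P.k p))
    (total-in (OrderIdeal.member I′) (inP p))))
  ideal⇒orderIdeal
  where
  extend-cong : ∀ {f g} → (∀ p → f p ≡ g p) → ∀ {i j k} d → extend f i j k d ≡ extend g i j k d
  extend-cong f≗g (yes p) = f≗g _
  extend-cong f≗g (no _)  = refl

-- Ideals and corner sums

-- The length of the initial run of `true`, cut off at `K`.
run : (ℕ → Bool) → ℕ → ℕ
run f zero    = 0
run f (suc K) = if f 0 then suc (run (f ∘ suc) K) else 0

run≤ : ∀ f K → run f K ≤ K
run≤ f zero = z≤n
run≤ f (suc K) with f 0
... | true  = s≤s (run≤ (f ∘ suc) K)
... | false = z≤n

-- A downward closed `f` bounded by `K` is nothing but its initial run. This is how a number is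
-- recovered from the set of numbers below it.
run⇔ : ∀ f K → (∀ k → T (f (suc k)) → T (f k)) → (∀ k → T (f k) → k < K) → ∀ k →
  (k < run f K) ⇔ T (f k)
run⇔ f zero    pred bound k = mk⇔ (λ ()) λ t → contradiction (bound k t) λ ()
run⇔ f (suc K) pred bound k with f 0 in f₀
... | false = mk⇔ (λ ()) (λ t → ⊥-elim (subst T f₀ (all-pred k t)))
  where
  all-pred : ∀ k → T (f k) → T (f 0)
  all-pred zero    = id
  all-pred (suc k) = all-pred k ∘ pred k
run⇔ f (suc K) pred bound zero    | true = mk⇔ (λ _ → subst T (sym f₀) _) (λ _ → s≤s z≤n)
run⇔ f (suc K) pred bound (suc k) | true =
  mk⇔ (to ih ∘ ℕ.s≤s⁻¹) (s≤s ∘ from ih)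
  where ih = run⇔ (f ∘ suc) K (pred ∘ suc) (λ k → ℕ.s≤s⁻¹ ∘ bound (suc k)) k

-- Compares numbers as sets of smaller numbers, so that inequalities between levels become
-- implications between memberships.
≤-below : ∀ {a b} → (∀ {k} → k < a → k < b) → a ≤ b
≤-below {zero}  h = z≤n
≤-below {suc a} h = h ℕ.≤-refl

≤1+-below : ∀ {a b} → (∀ {k} → suc k < a → k < b) → a ≤ suc b
≤1+-below {zero}        h = z≤n
≤1+-below {suc zero}    h = s≤s z≤n
≤1+-below {suc (suc a)} h = s≤s (h ℕ.≤-refl)

-- Extends finite tables to all natural indices, to match `Ideal`. Indices past the end go to the
-- last one; the bounds required for membership keep this default from mattering.
clip : ∀ {k} → ℕ → Fin (suc k)
clip         zero    = zero
clip {zero}  (suc i) = zero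
clip {suc k} (suc i) = suc (clip i)

clip-inject₁ : ∀ {i k} (i<k : i < k) → clip i ≡ inject₁ (fromℕ< i<k)
clip-inject₁ {zero}  {suc k} _         = refl
clip-inject₁ {suc i} {suc k} (s≤s i<k) = cong suc (clip-inject₁ i<k)

clip-suc : ∀ {i k} (i<k : i < k) → clip (suc i) ≡ suc (fromℕ< i<k)
clip-suc {zero}  {suc k} _         = refl
clip-suc {suc i} {suc k} (s≤s i<k) = cong suc (clip-suc i<k)

clip-toℕ : ∀ {k} (i : Fin (suc k)) → clip (toℕ i) ≡ i
clip-toℕ zero            = refl
clip-toℕ {suc k} (suc i) = cong suc (clip-toℕ i)

module _ {m n : ℕ} where

  module _ (X : Ideal m n) where

    open Ideal X

    level : ℕ → ℕ → ℕ
    level (suc i) (suc j) = run (member i j) m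
    level _       _       = 0

    level⇔ : ∀ {i j k} → (k < level (suc i) (suc j)) ⇔ T (member i j k)
    level⇔ {i} {j} {k} = run⇔ (member i j) m (λ _ → lower-k)
      (λ k t → let (_ , (k≤i , i<m)) = support t in ℕ.≤-<-trans k≤i i<m) k

    -- Two covers give the two bounds: passing from `(i , j , k)` to `(i + 1 , j , k)` keeps the
    -- members, and passing from `(i + 1 , j , k + 1)` to `(i , j , k)` loses at most one. Next to
    -- the zero border, k ≤ i leaves only k = 0.
    level-grows-i : ∀ i j → i < m → (level i j ≤ level (suc i) j) ×
      (level (suc i) j ≤ suc (level i j))
    level-grows-i zero    zero    _   = z≤n , z≤n
    level-grows-i (suc i) zero    _   = z≤n , z≤n
    level-grows-i zero    (suc j) _   = z≤n , ≤1+-below λ {k} k< →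
      contradiction (proj₁ (proj₂ (support (to (level⇔ {0} {j} {suc k}) k<)))) λ ()
    level-grows-i (suc i) (suc j) i<m =
      ≤-below (λ k< → from level⇔ (raise-i (to level⇔ k<) i<m)) ,
        ≤1+-below (λ k< → from level⇔ (lower-i (to (level⇔ {suc i}) k<)))

    level-grows-j : ∀ i j → j < n → (level i j ≤ level i (suc j)) ×
      (level i (suc j) ≤ suc (level i j))
    level-grows-j zero    _       _   = z≤n , z≤n
    level-grows-j (suc i) zero    _   = z≤n , ≤1+-below λ {k} k< →
      contradiction (proj₁ (proj₁ (support (to (level⇔ {i} {0} {suc k}) k<)))) λ ()
    level-grows-j (suc i) (suc j) j<n =
      ≤-below (λ k< → from level⇔ (raise-j (to level⇔ k<) j<n)) ,
        ≤1+-below (λ k< → from level⇔ (lower-j (to (level⇔ {i}) k<)))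

    ideal⇒cornerSum : CornerSum m n
    ideal⇒cornerSum = record
      { corner      = λ i j → level (toℕ i) (toℕ j)
      ; top         = λ _ → refl
      ; left        = λ where
          zero    → refl
          (suc i) → refl
      ; grows-down  = λ i j →
          subst (λ x → (level x (toℕ j) ≤ level (suc (toℕ i)) (toℕ j)) ×
          (level (suc (toℕ i)) (toℕ j) ≤ suc (level x (toℕ j))))
          (sym (Fin.toℕ-inject₁ i)) (level-grows-i (toℕ i) (toℕ j) (Fin.toℕ<n i))
      ; grows-right = λ i j →
          subst (λ x → (level (toℕ i) x ≤ level (toℕ i) (suc (toℕ j))) ×
          (level (toℕ i) (suc (toℕ j)) ≤ suc (level (toℕ i) x)))
          (sym (Fin.toℕ-inject₁ j)) (level-grows-j (toℕ i) (toℕ j) (Fin.toℕ<n j))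
      }

  level-injective : ∀ (X X′ : Ideal m n) →
    (∀ (i : Fin (suc m)) (j : Fin (suc n)) → level X (toℕ i) (toℕ j) ≡ level X′ (toℕ i) (toℕ j)) →
    ∀ {i j k} → T (Ideal.member X i j k) → T (Ideal.member X′ i j k)
  level-injective X X′ eq {i} {j} {k} t =
    let ((_ , j<n) , (_ , i<m)) = Ideal.support X t in
    to (level⇔ X′)
      (subst (k <_) (subst₂ (λ i j → level X (suc i) (suc j) ≡ level X′ (suc i) (suc j))
      (Fin.toℕ-fromℕ< i<m) (Fin.toℕ-fromℕ< j<n) (eq (suc (fromℕ< i<m)) (suc (fromℕ< j<n))))
        (from (level⇔ X) t))

  level-cong : ∀ (X X′ : Ideal m n) → (∀ i j k → Ideal.member X i j k ≡ Ideal.member X′ i j k) →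
    ∀ i j → level X i j ≡ level X′ i j
  level-cong X X′ eq zero    _       = refl
  level-cong X X′ eq (suc i) zero    = refl
  level-cong X X′ eq (suc i) (suc j) = ℕ.≤-antisym
    (≤-below λ k< → from (level⇔ X′) (subst T (eq i j _) (to (level⇔ X) k<)))
    (≤-below λ k< → from (level⇔ X) (subst T (sym (eq i j _)) (to (level⇔ X′) k<)))

  module _ (C : CornerSum m n) where

    open CornerSum C

    cornerℕ : ℕ → ℕ → ℕ
    cornerℕ i j = corner (clip i) (clip j)

    cornerℕ-i : ∀ {i} j → i < m → (cornerℕ i j ≤ cornerℕ (suc i) j) ×
      (cornerℕ (suc i) j ≤ suc (cornerℕ i j))
    cornerℕ-i j i<m rewrite clip-inject₁ i<m | clip-suc i<m = grows-down (fromℕ< i<m) (clip j)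

    cornerℕ-j : ∀ i {j} → j < n → (cornerℕ i j ≤ cornerℕ i (suc j)) ×
      (cornerℕ i (suc j) ≤ suc (cornerℕ i j))
    cornerℕ-j i j<n rewrite clip-inject₁ j<n | clip-suc j<n = grows-right (clip i) (fromℕ< j<n)

    -- From the zero border the sums grow by at most 1 a step. This and its companion for j give the
    -- bounds k ≤ i and k ≤ j of the poset.
    cornerℕ≤i : ∀ i j → i ≤ m → cornerℕ i j ≤ i
    cornerℕ≤i zero    j _   = ℕ.≤-reflexive (top (clip j))
    cornerℕ≤i (suc i) j i<m = ℕ.≤-trans (proj₂ (cornerℕ-i j i<m)) (s≤s (cornerℕ≤i i j (ℕ.<⇒≤ i<m)))

    cornerℕ≤j : ∀ i j → j ≤ n → cornerℕ i j ≤ j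
    cornerℕ≤j i zero    _   = ℕ.≤-reflexive (left (clip i))
    cornerℕ≤j i (suc j) j<n = ℕ.≤-trans (proj₂ (cornerℕ-j i j<n)) (s≤s (cornerℕ≤j i j (ℕ.<⇒≤ j<n)))

    private
      below? : ∀ i j k → Dec ((i < m × j < n) × k < cornerℕ (suc i) (suc j))
      below? i j k = ((i ℕ.<? m) ×-dec (j ℕ.<? n)) ×-dec (k ℕ.<? cornerℕ (suc i) (suc j))

    cornerSum⇒ideal : Ideal m n
    cornerSum⇒ideal = record
      { member  = λ i j k → ⌊ below? i j k ⌋
      ; support = λ t → let ((i<m , j<n) , k<) = toWitness t in
          (ℕ.s≤s⁻¹ (ℕ.≤-trans k< (cornerℕ≤j _ _ j<n)) , j<n) ,
            (ℕ.s≤s⁻¹ (ℕ.≤-trans k< (cornerℕ≤i _ _ i<m)) , i<m)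
      ; raise-i = λ t 1+i<m → let ((i<m , j<n) , k<) = toWitness t in
          fromWitness ((1+i<m , j<n) , ℕ.≤-trans k< (proj₁ (cornerℕ-i _ 1+i<m)))
      ; raise-j = λ {i} t 1+j<n → let ((i<m , j<n) , k<) = toWitness t in
          fromWitness ((i<m , 1+j<n) , ℕ.≤-trans k< (proj₁ (cornerℕ-j (suc i) 1+j<n)))
      ; lower-i = λ t → let ((i<m , j<n) , k<) = toWitness t in
          fromWitness ((ℕ.<⇒≤ i<m , j<n) , ℕ.s≤s⁻¹ (ℕ.≤-trans k< (proj₂ (cornerℕ-i _ i<m))))
      ; lower-j = λ {i} t → let ((i<m , j<n) , k<) = toWitness t in
          fromWitness ((i<m , ℕ.<⇒≤ j<n) , ℕ.s≤s⁻¹ (ℕ.≤-trans k< (proj₂ (cornerℕ-j (suc i) j<n))))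
      }

    level-cornerSum : ∀ (i : Fin (suc m)) (j : Fin (suc n)) →
      level cornerSum⇒ideal (toℕ i) (toℕ j) ≡ corner i j
    level-cornerSum zero    j       = sym (top j)
    level-cornerSum (suc i) zero    = sym (left (suc i))
    level-cornerSum (suc i) (suc j) = trans
      (ℕ.≤-antisym
        (≤-below λ k< → proj₂ (toWitness (to (level⇔ cornerSum⇒ideal) k<)))
        (≤-below λ k< →
          from (level⇔ cornerSum⇒ideal) (fromWitness ((Fin.toℕ<n i , Fin.toℕ<n j) , k<))))
      (cong₂ corner (clip-toℕ (suc i)) (clip-toℕ (suc j)))

ideal↔cornerSum : ∀ m n → Bijection (ideals m n) (cornerSums m n)
ideal↔cornerSum m n = bijection ideal⇒cornerSum
  (λ {X} {X′} X≈X′ (i , j) → level-cong X X′ (λ i j k → X≈X′ (i , j , k)) (toℕ i) (toℕ j))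
  (λ {X} {X′} eq (i , j , k) → T⇔⇒≡
    (level-injective X X′ (λ i j → eq (i , j))) (level-injective X′ X (λ i j → sym (eq (i , j)))))
  (λ C → cornerSum⇒ideal C , λ (i , j) → level-cornerSum C i j)

-- Monotone triangles

toℕ-clip : ∀ {k i} → i ≤ k → toℕ (clip {k} i) ≡ i
toℕ-clip {k}     {zero}  _         = refl
toℕ-clip {suc k} {suc i} (s≤s i≤k) = cong suc (toℕ-clip i≤k)

∸-suc : ∀ {k n} → suc k ≤ n → n ∸ k ≡ suc (n ∸ suc k)
∸-suc {k} {n} k<n = ℕ.+-∸-assoc 1 {n} {suc k} k<n

∸-suc-< : ∀ {k n} → k < n → n ∸ suc k < n
∸-suc-< {k} {n} k<n = subst (_≤ n) (∸-suc k<n) (ℕ.m∸n≤m n k)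

-- With t = n - 1 - j, membership of `(i , j , k)` in the ideal of a triangle becomes t < b, so that
-- each entry b counts the members along a line in the direction of j.
complement-≤ : ∀ {n j} b → j < n → (n ≤ j + b) ⇔ (n ∸ suc j < b)
complement-≤ {n} {j} b j<n = mk⇔
  (λ n≤ → subst (_≤ b) (∸-suc j<n) (ℕ.m≤n+o⇒m∸n≤o n j n≤))
  (λ < → ℕ.≤-trans (ℕ.m≤n+m∸n n j) (ℕ.+-monoʳ-≤ j (subst (_≤ b) (sym (∸-suc j<n)) <)))

complement-involutive : ∀ {n j} → j < n → n ∸ suc (n ∸ suc j) ≡ j
complement-involutive {suc n} (s≤s j≤n) = ℕ.m∸[m∸n]≡n j≤n

module _ {m n : ℕ} where

  module _ (B : PartialMonotoneTriangle m n) where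

    open PartialMonotoneTriangle B

    valueAt : ∀ {i} → Dec (i < m) → ℕ → ℕ
    valueAt (yes i<m) s = toℕ (entry (fromℕ< i<m) (clip s))
    valueAt (no _)    s = 0

    value : ℕ → ℕ → ℕ
    value i = valueAt (i ℕ.<? m)

    value-in : ∀ {i} (i<m : i < m) s → value i s ≡ toℕ (entry (fromℕ< i<m) (clip s))
    value-in {i} i<m s with i ℕ.<? m
    ... | yes _  = refl
    ... | no i≮m = contradiction i<m i≮m

    value-entry : ∀ r s → value (toℕ r) (toℕ s) ≡ toℕ (entry r s)
    value-entry r s = trans (value-in (Fin.toℕ<n r) (toℕ s)) (same (Fin.fromℕ<-toℕ r _) s)
      where
      same : ∀ {r r′} → r′ ≡ r → (s : Fin (suc (toℕ r))) → toℕ (entry r′ (clip (toℕ s))) ≡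
        toℕ (entry r s)
      same {r} refl s = cong (toℕ ∘ entry r) (clip-toℕ s)

    value≤n : ∀ i s → value i s ≤ n
    value≤n i s with i ℕ.<? m
    ... | yes i<m = ℕ.s≤s⁻¹ (Fin.toℕ<n (entry (fromℕ< i<m) (clip s)))
    ... | no _    = z≤n

    module _ {i : ℕ} (i<m : i < m) where

      private
        r : Fin m
        r = fromℕ< i<m
        r≡i : toℕ r ≡ i
        r≡i = Fin.toℕ-fromℕ< i<m
        index : ∀ {s} → s ≤ i → toℕ (clip {toℕ r} s) ≡ s
        index s≤i = toℕ-clip (subst (_ ≤_) (sym r≡i) s≤i)

      value-row : ∀ {s} → s < i → value i s ≤ value i (suc s)
      value-row {s} s<i = subst₂ _≤_ (sym (value-in i<m s)) (sym (value-in i<m (suc s)))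
        (rows-weakly-increasing r (clip s) (clip (suc s))
          (trans (index s<i) (cong suc (sym (index (ℕ.<⇒≤ s<i))))))

      value-strict : ∀ {s} → s < i → 0 < value i s → value i s < value i (suc s)
      value-strict {s} s<i 0<v = subst₂ _<_ (sym (value-in i<m s)) (sym (value-in i<m (suc s)))
        (nonzero-strictly-increasing r (clip s) (clip (suc s))
          (ℕ.≤-reflexive (trans (cong suc (index (ℕ.<⇒≤ s<i))) (sym (index s<i))))
          (nonzero s 0<v) (nonzero (suc s) (ℕ.<-≤-trans 0<v (value-row s<i))))
        where
        nonzero : ∀ s → 0 < value i s → entry r (clip s) ≢ zero
        nonzero s 0<v eq = ℕ.n≮0 (subst (0 <_) (trans (value-in i<m s) (cong toℕ eq)) 0<v)

      -- To the right of a nonzero entry stand k more, each strictly larger and at most n. This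
      -- yields the bound k ≤ j of the poset, so that no part of an entry falls outside it.
      value-room : ∀ k {s} → s + k ≡ i → 0 < value i s → value i s + k ≤ n
      value-room zero    {s} _  _   = subst (_≤ n) (sym (ℕ.+-identityʳ _)) (value≤n i s)
      value-room (suc k) {s} eq 0<v = begin
        value i s + suc k   ≡⟨ ℕ.+-suc (value i s) k ⟩
        suc (value i s) + k ≤⟨ ℕ.+-monoˡ-≤ k v<v′ ⟩
        value i (suc s) + k ≤⟨ value-room k (trans (sym (ℕ.+-suc s k)) eq) (ℕ.<-trans 0<v v<v′) ⟩
        n                   ∎
        where
        open ℕ.≤-Reasoning
        v<v′ = value-strict (subst (s <_) eq (ℕ.m<m+n s (s≤s z≤n))) 0<v

      value-diagonal : ∀ {s} → suc i < m → s ≤ i → (value (suc i) s ≤ value i s) ×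
        (value i s ≤ value (suc i) (suc s))
      value-diagonal {s} 1+i<m s≤i
        rewrite value-in i<m s | value-in 1+i<m s | value-in 1+i<m (suc s) =
        diagonals-weakly-increasing r (fromℕ< 1+i<m) (trans r′≡1+i (cong suc (sym r≡i)))
          (clip s) (clip s) (clip (suc s))
          (trans (toℕ-clip (subst (s ≤_) (sym r′≡1+i) (ℕ.m≤n⇒m≤1+n s≤i))) (sym (index s≤i)))
          (trans (toℕ-clip (subst (suc s ≤_) (sym r′≡1+i) (s≤s s≤i))) (cong suc (sym (index s≤i))))
        where r′≡1+i = Fin.toℕ-fromℕ< 1+i<m

    private
      above? : ∀ i j k → Dec (InP m n i j k × n ≤ j + value i (i ∸ k))
      above? i j k = inP? m n i j k ×-dec (n ℕ.≤? j + value i (i ∸ k))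

    -- The two diagonal inequalities are the two closure conditions in i, and strictness along a row
    -- is `lower-j`, since k counts entries from the right end of the row; `raise-j` only enlarges j
    -- + b.
    triangle⇒ideal : Ideal m n
    triangle⇒ideal = record
      { member  = λ i j k → ⌊ above? i j k ⌋
      ; support = proj₁ ∘ toWitness
      ; raise-i = λ {i} {j} {k} t 1+i<m → let ((k≤j , j<n) , (k≤i , i<m)) , n≤ = toWitness t in
          fromWitness (((k≤j , j<n) , (ℕ.m≤n⇒m≤1+n k≤i , 1+i<m)) , ℕ.≤-trans n≤ (ℕ.+-monoʳ-≤ j
            (subst (λ s → value i (i ∸ k) ≤ value (suc i) s) (sym (ℕ.+-∸-assoc 1 k≤i))
              (proj₂ (value-diagonal i<m 1+i<m (ℕ.m∸n≤m i k))))))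
      ; raise-j = λ t 1+j<n → let ((k≤j , j<n) , i∈) , n≤ = toWitness t in
          fromWitness (((ℕ.m≤n⇒m≤1+n k≤j , 1+j<n) , i∈) , ℕ.m≤n⇒m≤1+n n≤)
      ; lower-i = λ {i} {j} {k} t → let ((k<j , j<n) , (k≤i , 1+i<m)) , n≤ = toWitness t in
          fromWitness
            (((ℕ.<⇒≤ k<j , j<n) , (ℕ.s≤s⁻¹ k≤i , ℕ.<⇒≤ 1+i<m)) , ℕ.≤-trans n≤ (ℕ.+-monoʳ-≤ j
            (proj₁ (value-diagonal (ℕ.<⇒≤ 1+i<m) 1+i<m (ℕ.m∸n≤m i k)))))
      -- Strictness applies because n ≤ (j + 1) + b with j + 1 < n forces the entry b to be
      -- positive.
      ; lower-j = λ {i} {j} {k} t → let ((k≤j , 1+j<n) , (k<i , i<m)) , n≤ = toWitness t in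
          fromWitness (((ℕ.s≤s⁻¹ k≤j , ℕ.<⇒≤ 1+j<n) , (ℕ.<⇒≤ k<i , i<m)) , ℕ.≤-trans n≤
            (subst (_≤ j + value i (i ∸ k)) (ℕ.+-suc j _) (ℕ.+-monoʳ-≤ j
              (subst (λ s → value i (i ∸ suc k) < value i s) (sym (∸-suc k<i))
                (value-strict i<m (subst (_≤ i) (∸-suc k<i) (ℕ.m∸n≤m i k))
                  (ℕ.≤-trans (s≤s z≤n) (to (complement-≤ _ 1+j<n) n≤)))))))
      }

    -- Recovers an entry from the ideal, which gives injectivity; `size` below takes the right-hand
    -- side as its definition.
    value⇔ : ∀ {i s t} → i < m → s ≤ i →
      (t < value i s) ⇔ ((t < n) × T (Ideal.member triangle⇒ideal i (n ∸ suc t) (i ∸ s)))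
    value⇔ {i} {s} {t} i<m s≤i = mk⇔ ⇒ λ (t<n , x) → ⇐ t<n (proj₂ (toWitness x))
      where
      ⇐ : t < n → n ≤ n ∸ suc t + value i (i ∸ (i ∸ s)) → t < value i s
      ⇐ t<n n≤ = subst₂ _<_ (complement-involutive t<n) (cong (value i) (ℕ.m∸[m∸n]≡n s≤i))
        (to (complement-≤ _ (∸-suc-< t<n)) n≤)
      ⇒ : t < value i s → (t < n) × T (Ideal.member triangle⇒ideal i (n ∸ suc t) (i ∸ s))
      ⇒ t<v = t<n , fromWitness (((room , ∸-suc-< t<n) , (ℕ.m∸n≤m i s , i<m)) ,
          from (complement-≤ _ (∸-suc-< t<n))
            (subst₂ _<_ (sym (complement-involutive t<n)) (cong (value i) (sym (ℕ.m∸[m∸n]≡n s≤i)))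
              t<v))
        where
        t<n : t < n
        t<n = ℕ.<-≤-trans t<v (value≤n i s)
        room : i ∸ s ≤ n ∸ suc t
        room = ℕ.m+n≤o⇒m≤o∸n (i ∸ s) (ℕ.≤-trans
          (ℕ.≤-trans (ℕ.≤-reflexive (ℕ.+-comm (i ∸ s) (suc t))) (ℕ.+-monoˡ-≤ (i ∸ s) t<v))
          (value-room i<m (i ∸ s) (ℕ.m+[n∸m]≡n s≤i) (ℕ.≤-<-trans z≤n t<v)))

  module _ (X : Ideal m n) where

    open Ideal X

    private
      column? : ∀ i s t → Dec ((t < n) × T (member i (n ∸ suc t) (i ∸ s)))
      column? i s t = (t ℕ.<? n) ×-dec T? (member i (n ∸ suc t) (i ∸ s))

    size : ℕ → ℕ → ℕ
    size i s = run (λ t → ⌊ column? i s t ⌋) n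

    size⇔ : ∀ i s {t} → (t < size i s) ⇔ ((t < n) × T (member i (n ∸ suc t) (i ∸ s)))
    size⇔ i s {t} = mk⇔ (toWitness ∘ to e) (from e ∘ fromWitness)
      where
      pred : ∀ t → T ⌊ column? i s (suc t) ⌋ → T ⌊ column? i s t ⌋
      pred t x = let (1+t<n , x∈) = toWitness x in
        fromWitness (ℕ.<⇒≤ 1+t<n , subst (λ j → T (member i j (i ∸ s))) (sym (∸-suc 1+t<n))
          (raise-j x∈ (subst (_< n) (∸-suc 1+t<n) (∸-suc-< (ℕ.<⇒≤ 1+t<n)))))
      e : (t < size i s) ⇔ T ⌊ column? i s t ⌋
      e = run⇔ _ n pred (λ _ → proj₁ ∘ toWitness) t

    size≤n : ∀ i s → size i s ≤ n
    size≤n i s = run≤ _ n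

    size-row : ∀ {i s} → s < i → size i s ≤ size i (suc s)
    size-row {i} {s} s<i = ≤-below λ {t} t< → let (t<n , x) = to (size⇔ i s) t< in
      from (size⇔ i (suc s))
        (t<n , lower-k (subst (λ k → T (member i (n ∸ suc t) k)) (∸-suc s<i) x))

    -- `lower-j` applied to the last member, t = size - 1, gives a member at t + 1 on the next line.
    size-strict : ∀ {i s} → s < i → 0 < size i s → size i s < size i (suc s)
    size-strict {i} {s} s<i 0<v =
      subst (_< size i (suc s)) (ℕ.m+[n∸m]≡n 0<v)
      (next (to (size⇔ i s) (ℕ.≤-reflexive (ℕ.m+[n∸m]≡n 0<v))))
      where
      next : ∀ {t} → (t < n) × T (member i (n ∸ suc t) (i ∸ s)) → suc t < size i (suc s)
      next {t} (t<n , x) =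
        from (size⇔ i (suc s))
        (1+t<n , lower-j (subst₂ (λ j k → T (member i j k)) (∸-suc 1+t<n) (∸-suc s<i) x))
        where
        -- The third coordinate `i ∸ s` is positive and, by the support, at most `n ∸ suc t`, so the
        -- latter is not 0.
        1+t<n : suc t < n
        1+t<n = ℕ.m∸n≢0⇒n<m λ eq → ℕ.n≮0 (ℕ.<-≤-trans (ℕ.m<n⇒0<n∸m s<i)
          (subst (i ∸ s ≤_) eq (proj₁ (proj₁ (support x)))))

    size-strict* : ∀ {i s s′} → s < s′ → s′ ≤ i → 0 < size i s → size i s < size i s′
    size-strict* {s′ = suc s′} s<s′ s′≤i 0<v with ℕ.m≤n⇒m<n∨m≡n (ℕ.s≤s⁻¹ s<s′)
    ... | inj₁ s<s″ = ℕ.<-≤-trans (size-strict* s<s″ (ℕ.<⇒≤ s′≤i) 0<v) (size-row s′≤i)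
    ... | inj₂ refl = size-strict s′≤i 0<v

    size-diagonal : ∀ {i s} → suc i < m → s ≤ i → (size (suc i) s ≤ size i s) ×
      (size i s ≤ size (suc i) (suc s))
    size-diagonal {i} {s} 1+i<m s≤i =
      ≤-below (λ {t} t< → let (t<n , x) = to (size⇔ (suc i) s) t< in
        from (size⇔ i s)
          (t<n , lower-i (subst (λ k → T (member (suc i) (n ∸ suc t) k)) (ℕ.+-∸-assoc 1 s≤i) x))) ,
      ≤-below (λ t< →
          let (t<n , x) = to (size⇔ i s) t<
          in from (size⇔ (suc i) (suc s)) (t<n , raise-i x 1+i<m))

    ideal⇒triangle : PartialMonotoneTriangle m n
    ideal⇒triangle = record
      { entry                       = entry
      ; rows-weakly-increasing      = λ r s s′ s′≡1+s →
          subst₂ _≤_ (sym (toℕ-entry r s)) (sym (toℕ-entry r s′))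
          (subst (λ x → size (toℕ r) (toℕ s) ≤ size (toℕ r) x) (sym s′≡1+s)
            (size-row (subst (_≤ toℕ r) s′≡1+s (ℕ.s≤s⁻¹ (Fin.toℕ<n s′)))))
      ; nonzero-strictly-increasing = λ r s s′ s<s′ ≢0 _ →
          subst₂ _<_ (sym (toℕ-entry r s)) (sym (toℕ-entry r s′))
          (size-strict* s<s′ (ℕ.s≤s⁻¹ (Fin.toℕ<n s′))
            (subst (0 <_) (toℕ-entry r s) (ℕ.n≢0⇒n>0 (≢0 ∘ Fin.toℕ-injective))))
      ; diagonals-weakly-increasing = λ r r′ r′≡1+r s t t′ t≡s t′≡1+s →
          let 1+r<m = subst (_< m) r′≡1+r (Fin.toℕ<n r′)
              (p , q) = size-diagonal 1+r<m (ℕ.s≤s⁻¹ (Fin.toℕ<n s))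
          in subst₂ _≤_ (trans (cong₂ size (sym r′≡1+r) (sym t≡s)) (sym (toℕ-entry r′ t)))
            (sym (toℕ-entry r s)) p ,
             subst₂ _≤_ (sym (toℕ-entry r s))
               (trans (cong₂ size (sym r′≡1+r) (sym t′≡1+s)) (sym (toℕ-entry r′ t′))) q
      }
      where
      entry : (r : Fin m) → Fin (suc (toℕ r)) → Fin (suc n)
      entry r s = fromℕ< (s≤s (size≤n (toℕ r) (toℕ s)))
      toℕ-entry : ∀ r s → toℕ (entry r s) ≡ size (toℕ r) (toℕ s)
      toℕ-entry r s = Fin.toℕ-fromℕ< (s≤s (size≤n (toℕ r) (toℕ s)))

    value-size : ∀ {i s} → i < m → s ≤ i → value ideal⇒triangle i s ≡ size i s
    value-size {i} {s} i<m s≤i = trans (value-in ideal⇒triangle i<m s) (trans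
      (Fin.toℕ-fromℕ< (s≤s (size≤n (toℕ (fromℕ< i<m)) (toℕ (clip {toℕ (fromℕ< i<m)} s)))))
      (cong₂ size (Fin.toℕ-fromℕ< i<m) (toℕ-clip (subst (s ≤_) (sym (Fin.toℕ-fromℕ< i<m)) s≤i))))

    triangle-ideal : ∀ i j k → Ideal.member (triangle⇒ideal ideal⇒triangle) i j k ≡ member i j k
    triangle-ideal i j k = T⇔⇒≡
      (λ t → let ((_ , j<n) , (k≤i , i<m)) , n≤ = toWitness t in
        subst₂ (λ j k → T (member i j k)) (complement-involutive j<n) (ℕ.m∸[m∸n]≡n k≤i)
          (proj₂ (to (size⇔ i (i ∸ k))
            (subst (n ∸ suc j <_) (value-size i<m (ℕ.m∸n≤m i k)) (to (complement-≤ _ j<n) n≤)))))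
      (λ t → let ((_ , j<n) , (k≤i , i<m)) = support t in
        fromWitness
          (support t ,
          from (complement-≤ _ j<n) (subst (n ∸ suc j <_) (sym (value-size i<m (ℕ.m∸n≤m i k)))
          (from (size⇔ i (i ∸ k)) (∸-suc-< j<n , subst₂ (λ j k → T (member i j k))
            (sym (complement-involutive j<n)) (sym (ℕ.m∸[m∸n]≡n k≤i)) t)))))

  value-cong : ∀ (B B′ : PartialMonotoneTriangle m n) → let open PartialMonotoneTriangle in
    (∀ r s → entry B r s ≡ entry B′ r s) → ∀ {i} (d : Dec (i < m)) s →
      valueAt B d s ≡ valueAt B′ d s
  value-cong B B′ eq (yes i<m) s = cong toℕ (eq (fromℕ< i<m) (clip s))
  value-cong B B′ eq (no _)    s = refl

  value-injective : ∀ (B B′ : PartialMonotoneTriangle m n) →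
    (∀ i j k → Ideal.member (triangle⇒ideal B) i j k ≡ Ideal.member (triangle⇒ideal B′) i j k) →
    ∀ {i s} → i < m → s ≤ i → value B i s ≤ value B′ i s
  value-injective B B′ eq i<m s≤i = ≤-below λ t< →
    let (t<n , x) = to (value⇔ B i<m s≤i) t< in from (value⇔ B′ i<m s≤i) (t<n , subst T (eq _ _ _) x)

triangle↔ideal : ∀ m n → Bijection (partialMonotoneTriangles m n) (ideals m n)
triangle↔ideal m n = bijection triangle⇒ideal
  (λ {B} {B′} B≈B′ (i , j , k) →
    cong (λ v → ⌊ inP? m n i j k ×-dec (n ℕ.≤? j + v) ⌋)
      (value-cong B B′ (λ r s → B≈B′ (r , s)) (i ℕ.<? m) (i ∸ k)))
  (λ {B} {B′} eq (r , s) → Fin.toℕ-injective (trans (sym (value-entry B r s)) (trans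
    (let r<m = Fin.toℕ<n r; s≤r = ℕ.s≤s⁻¹ (Fin.toℕ<n s) in ℕ.≤-antisym
      (value-injective B B′ (λ i j k → eq (i , j , k)) r<m s≤r)
      (value-injective B′ B (λ i j k → sym (eq (i , j , k))) r<m s≤r))
    (value-entry B′ r s))))
  (λ X → ideal⇒triangle X , λ (i , j , k) → triangle-ideal X i j k)

-- Alternating sign matrices

-- partial b v i is b + v 0 + … + v (i − 1), provided that all these partial sums lie in {0 , 1}

next : Bool → ℤ → Bool
next b (ℤ.+ zero)  = b
next b (ℤ.+ suc _) = true
next b ℤ.-[1+ _ ]  = false

partial : ∀ {k} → Bool → (Fin k → ℤ) → Fin (suc k) → Bool
partial         b v zero    = b
partial {suc k} b v (suc i) = partial (next b (v zero)) (v ∘ suc) i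

partial-cong : ∀ {k} b {v v′ : Fin k → ℤ} → (∀ c → v c ≡ v′ c) → ∀ i →
  partial b v i ≡ partial b v′ i
partial-cong         b v≗v′ zero    = refl
partial-cong {suc k} b {v} v≗v′ (suc i) rewrite sym (v≗v′ zero) =
  partial-cong (next b (v zero)) (v≗v′ ∘ suc) i

-- The integer `bit y − bit x`.
δ : Bool → Bool → ℤ
δ false true  = 1ℤ
δ true  false = -1ℤ
δ _     _     = 0ℤ

next-δ : ∀ x y → next x (δ x y) ≡ y
next-δ false false = refl
next-δ false true  = refl
next-δ true  false = refl
next-δ true  true  = refl

-- Transposing terms: b - a = d - c is a + d = b + c. A matrix entry is a mixed second difference of
-- corner sums, and the balance says that it may be taken in either order.
δ-balance : ∀ a b c d → δ a b ≡ δ c d → bit a + bit d ≡ bit b + bit c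
δ-balance = from-yes (∀Bool? λ a → ∀Bool? λ b → ∀Bool? λ c → ∀Bool? λ d →
  (δ a b ℤ.≟ δ c d) →-dec (bit a + bit d ℕ.≟ bit b + bit c))

balance-δ : ∀ a b c d → bit a + bit d ≡ bit b + bit c → δ a b ≡ δ c d
balance-δ = from-yes (∀Bool? λ a → ∀Bool? λ b → ∀Bool? λ c → ∀Bool? λ d →
  (bit a + bit d ℕ.≟ bit b + bit c) →-dec (δ a b ℤ.≟ δ c d))

δ-+ : ∀ x y z → δ x y ℤ.+ δ y z ≡ δ x z
δ-+ = from-yes (∀Bool? λ x → ∀Bool? λ y → ∀Bool? λ z → δ x y ℤ.+ δ y z ℤ.≟ δ x z)

δ-range : ∀ x y → (δ x y ≡ -1ℤ) ⊎ (δ x y ≡ 0ℤ) ⊎ (δ x y ≡ 1ℤ)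
δ-range = from-yes
  (∀Bool? λ x → ∀Bool? λ y → (δ x y ℤ.≟ -1ℤ) ⊎-dec ((δ x y ℤ.≟ 0ℤ) ⊎-dec (δ x y ℤ.≟ 1ℤ)))

δ-false : ∀ y → (δ false y ≡ 0ℤ) ⊎ (δ false y ≡ 1ℤ)
δ-false = from-yes (∀Bool? λ y → (δ false y ℤ.≟ 0ℤ) ⊎-dec (δ false y ℤ.≟ 1ℤ))

δ≡0 : ∀ x y → δ x y ≡ 0ℤ → x ≡ y
δ≡0 false false _ = refl
δ≡0 true  true  _ = refl

δ-same : ∀ x → δ x x ≡ 0ℤ
δ-same false = refl
δ-same true  = refl

δ-alternates : ∀ x y z → δ x y ≢ 0ℤ → δ y z ≢ 0ℤ → sign (δ x y) ≡ Sign.opposite (sign (δ y z))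
δ-alternates = from-yes (∀Bool? λ x → ∀Bool? λ y → ∀Bool? λ z →
  ¬? (δ x y ℤ.≟ 0ℤ) →-dec
    (¬? (δ y z ℤ.≟ 0ℤ) →-dec (sign (δ x y) Sign.≟ Sign.opposite (sign (δ y z)))))

module _ {k : ℕ} (v : Fin k → ℤ) where

  -- `u` gives partial sums of `v`, taken from the left or from the right up to the starting bit.
  -- Being such a difference of bits, with a zero start, is what the conditions on a column or row
  -- of the matrix amount to.
  Rises Falls : (Fin (suc k) → Bool) → Set
  Rises u = ∀ c → v c ≡ δ (u (inject₁ c)) (u (suc c))
  Falls u = ∀ c → v c ≡ δ (u (suc c)) (u (inject₁ c))

partial-unique : ∀ {k} b (v : Fin k → ℤ) u → Rises v u → u zero ≡ b → ∀ i → partial b v i ≡ u i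
partial-unique         b v u rises u₀ zero    = sym u₀
partial-unique {suc k} b v u rises u₀ (suc i) = partial-unique (next b (v zero)) (v ∘ suc) (u ∘ suc)
  (rises ∘ suc)
  (sym (trans (cong₂ next (sym u₀) (rises zero)) (next-δ (u zero) (u (suc zero))))) i

Alternates : ∀ {k} → (Fin k → ℤ) → Set
Alternates = NonzeroEntriesAlternate

-- The only nonzero entry that can follow when the sum so far is the given bit.
leading : Bool → ℤ
leading false = 1ℤ
leading true  = -1ℤ

InRange : ℤ → Set
InRange x = (x ≡ -1ℤ) ⊎ (x ≡ 0ℤ) ⊎ (x ≡ 1ℤ)

leading-rises : ∀ b {x} → InRange x → (x ≢ 0ℤ → x ≡ leading b) → x ≡ δ b (next b x)
leading-rises false (inj₁ refl)        lead with () ← lead (λ ())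
leading-rises true  (inj₁ refl)        lead = refl
leading-rises false (inj₂ (inj₁ refl)) lead = refl
leading-rises true  (inj₂ (inj₁ refl)) lead = refl
leading-rises false (inj₂ (inj₂ refl)) lead = refl
leading-rises true  (inj₂ (inj₂ refl)) lead with () ← lead (λ ())

opposite-leading : ∀ b {x y} → InRange x → InRange y → x ≢ 0ℤ → y ≢ 0ℤ →
  sign x ≡ Sign.opposite (sign y) → y ≡ leading (next b x)
opposite-leading b (inj₂ (inj₁ refl)) _                  x≢0 _ _ = contradiction refl x≢0
opposite-leading b _                  (inj₂ (inj₁ refl)) _ y≢0 _ = contradiction refl y≢0
opposite-leading b (inj₁ refl)        (inj₁ refl)        _ _ ()
opposite-leading b (inj₁ refl)        (inj₂ (inj₂ refl)) _ _ _ = refl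
opposite-leading b (inj₂ (inj₂ refl)) (inj₁ refl)        _ _ _ = refl
opposite-leading b (inj₂ (inj₂ refl)) (inj₂ (inj₂ refl)) _ _ ()

-- Induction with the sum so far as `b`. The hypothesis on the first nonzero entry carries over to
-- the tail: unchanged if the head is 0, and by alternation otherwise.
partial-rises : ∀ {k} b (v : Fin k → ℤ) → (∀ c → InRange (v c)) → Alternates v →
  (∀ a → v a ≢ 0ℤ → (∀ c → c Fin.< a → v c ≡ 0ℤ) → v a ≡ leading b) → Rises v (partial b v)
partial-rises b v range alternates first zero =
  leading-rises b (range zero) (λ v₀≢0 → first zero v₀≢0 λ _ ())
partial-rises b v range alternates first (suc c) =
  partial-rises (next b (v zero)) (v ∘ suc) (range ∘ suc)
  (λ a a′ a<a′ va≢0 va′≢0 zeros → alternates (suc a) (suc a′) (s≤s a<a′) va≢0 va′≢0 λ where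
    (suc c) (s≤s a<c) (s≤s c<a′) → zeros c a<c c<a′)
  first′ c
  where
  first′ : ∀ a → v (suc a) ≢ 0ℤ → (∀ c → c Fin.< a → v (suc c) ≡ 0ℤ) →
    v (suc a) ≡ leading (next b (v zero))
  first′ a va≢0 zeros with v zero ℤ.≟ 0ℤ
  ... | yes v₀≡0 = trans
    (first (suc a) va≢0 λ where
      zero    _         → v₀≡0
      (suc c) (s≤s c<a) → zeros c c<a)
    (cong (leading ∘ next b) (sym v₀≡0))
  ... | no v₀≢0 = opposite-leading b (range zero) (range (suc a)) v₀≢0 va≢0
    (alternates zero (suc a) (s≤s z≤n) v₀≢0 va≢0 λ where
      (suc c) _ (s≤s c<a) → zeros c c<a)

constant-between : ∀ {k} (v : Fin k → ℤ) (u : Fin (suc k) → Bool) →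
  (∀ c → v c ≡ 0ℤ → u (inject₁ c) ≡ u (suc c)) →
  ∀ i j → i Fin.≤ j → (∀ c → toℕ i ≤ toℕ c → c Fin.< j → v c ≡ 0ℤ) → u i ≡ u j
constant-between v u same zero zero _ zeros = refl
constant-between {suc k} v u same zero (suc j) _ zeros =
  trans (same zero (zeros zero z≤n (s≤s z≤n)))
    (constant-between (v ∘ suc) (u ∘ suc) (same ∘ suc) zero j z≤n
      (λ c _ c<j → zeros (suc c) z≤n (s≤s c<j)))
constant-between {suc k} v u same (suc i) (suc j) (s≤s i≤j) zeros =
  constant-between (v ∘ suc) (u ∘ suc) (same ∘ suc) i j i≤j
    (λ c i≤c c<j → zeros (suc c) (s≤s i≤c) (s≤s c<j))

module _ {k} (v : Fin k → ℤ) (u : Fin (suc k) → Bool) where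

  private
    module _ (same : ∀ c → v c ≡ 0ℤ → u (inject₁ c) ≡ u (suc c)) where

      constant-inside : ∀ a b → a Fin.< b → (∀ c → a Fin.< c → c Fin.< b → v c ≡ 0ℤ) →
        u (suc a) ≡ u (inject₁ b)
      constant-inside a b a<b zeros = constant-between v u same (suc a) (inject₁ b)
        (subst (toℕ a <_) (sym (Fin.toℕ-inject₁ b)) a<b)
        (λ c a<c c<b → zeros c a<c (subst (toℕ c <_) (Fin.toℕ-inject₁ b) c<b))

      constant-before : ∀ a → (∀ c → c Fin.< a → v c ≡ 0ℤ) → u zero ≡ u (inject₁ a)
      constant-before a zeros = constant-between v u same zero (inject₁ a) z≤n
        (λ c _ c<a → zeros c (subst (toℕ c <_) (Fin.toℕ-inject₁ a) c<a))

      constant-after : ∀ a → (∀ c → a Fin.< c → v c ≡ 0ℤ) → u (suc a) ≡ u (fromℕ k)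
      constant-after a zeros = constant-between v u same (suc a) (fromℕ k)
        (subst (toℕ (suc a) ≤_) (sym (Fin.toℕ-fromℕ k)) (Fin.toℕ<n a)) (λ c a<c _ → zeros c a<c)

    nonzero⇒1 : ∀ {x} y → x ≡ δ false y → x ≢ 0ℤ → x ≡ 1ℤ
    nonzero⇒1 y eq x≢0 = case δ-false y of λ where
      (inj₁ 0≡) → contradiction (trans eq 0≡) x≢0
      (inj₂ 1≡) → trans eq 1≡

  module _ (rises : Rises v u) where

    private
      same : ∀ c → v c ≡ 0ℤ → u (inject₁ c) ≡ u (suc c)
      same c eq = δ≡0 _ _ (trans (sym (rises c)) eq)

    -- `u` is constant between consecutive nonzero entries, so these are differences x → y and y → z
    -- with a common middle bit, one up and one down.
    rises⇒alternates : Alternates v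
    rises⇒alternates a b a<b va≢0 vb≢0 zeros with constant-inside same a b a<b zeros
    ... | eq rewrite rises a | rises b | eq = δ-alternates (u (inject₁ a)) _ (u (suc b)) va≢0 vb≢0

    rises⇒first : u zero ≡ false → FirstNonzeroIs1 v
    rises⇒first u₀ a va≢0 zeros = nonzero⇒1 (u (suc a)) (trans (rises a)
      (cong (λ x → δ x (u (suc a))) (trans (sym (constant-before same a zeros)) u₀))) va≢0

  module _ (falls : Falls v u) where

    private
      same : ∀ c → v c ≡ 0ℤ → u (inject₁ c) ≡ u (suc c)
      same c eq = sym (δ≡0 _ _ (trans (sym (falls c)) eq))

    falls⇒alternates : Alternates v
    falls⇒alternates a b a<b va≢0 vb≢0 zeros with constant-inside same a b a<b zeros
    ... | eq rewrite falls a | falls b | eq = δ-alternates′ (u (suc b)) _ (u (inject₁ a)) vb≢0 va≢0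
      where
      δ-alternates′ : ∀ x y z → δ x y ≢ 0ℤ → δ y z ≢ 0ℤ →
        sign (δ y z) ≡ Sign.opposite (sign (δ x y))
      δ-alternates′ x y z ≢0 ≢0′ =
        trans (sym (Sign.opposite-involutive _))
        (cong Sign.opposite (sym (δ-alternates x y z ≢0 ≢0′)))

    falls⇒last : u (fromℕ k) ≡ false → LastNonzeroIs1 v
    falls⇒last u₁ a va≢0 zeros = nonzero⇒1 (u (inject₁ a)) (trans (falls a)
      (cong (λ x → δ x (u (inject₁ a))) (trans (constant-after same a zeros) u₁))) va≢0

-- The sum telescopes; with a zero start it is the last bit, hence 0 or 1.
sum-rises : ∀ {k} (v : Fin k → ℤ) u → Rises v u → sum +-0-rawMonoid v ≡ δ (u zero) (u (fromℕ k))
sum-rises {zero}  v u rises = sym (δ-same (u zero))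
sum-rises {suc k} v u rises = trans
  (cong₂ ℤ._+_ (rises zero) (sum-rises (v ∘ suc) (u ∘ suc) (rises ∘ suc)))
  (δ-+ (u zero) (u (suc zero)) (u (suc (fromℕ k))))

sum-falls : ∀ {k} (v : Fin k → ℤ) u → Falls v u → sum +-0-rawMonoid v ≡ δ (u (fromℕ k)) (u zero)
sum-falls {zero}  v u falls = sym (δ-same (u zero))
sum-falls {suc k} v u falls = trans
  (cong₂ ℤ._+_ (falls zero) (sum-falls (v ∘ suc) (u ∘ suc) (falls ∘ suc)))
  (trans (ℤ.+-comm (δ (u (suc zero)) (u zero)) _) (δ-+ (u (suc (fromℕ k))) (u (suc zero)) (u zero)))

opposite-< : ∀ {k} {a b : Fin k} → a Fin.< b → opposite b Fin.< opposite a
opposite-< {k} {a} {b} a<b rewrite Fin.opposite-prop a | Fin.opposite-prop b =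
  ℕ.∸-monoʳ-< (s≤s a<b) (Fin.toℕ<n b)

alternates-opposite : ∀ {k} (v : Fin k → ℤ) → Alternates v → Alternates (v ∘ opposite)
alternates-opposite v alternates a b a<b va≢0 vb≢0 zeros =
  trans (sym (Sign.opposite-involutive _)) (cong Sign.opposite (sym
    (alternates (opposite b) (opposite a) (opposite-< a<b) vb≢0 va≢0 λ c b<c c<a →
      trans (cong v (sym (Fin.opposite-involutive c))) (zeros (opposite c)
        (subst (Fin._< opposite c) (Fin.opposite-involutive a) (opposite-< c<a))
        (subst (opposite c Fin.<_) (Fin.opposite-involutive b) (opposite-< b<c))))))

last⇒first-opposite : ∀ {k} (v : Fin k → ℤ) → LastNonzeroIs1 v → FirstNonzeroIs1 (v ∘ opposite)
last⇒first-opposite v last a va≢0 zeros = last (opposite a) va≢0 λ c a<c →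
  trans (cong v (sym (Fin.opposite-involutive c))) (zeros (opposite c)
    (subst (opposite c Fin.<_) (Fin.opposite-involutive a) (opposite-< a<c)))

-- Columns are reflected, so that both the sums down a column and the sums along
-- a row start at the side where the first nonzero entry is 1.

module _ {m n : ℕ} where

  asmIncrement : (Fin m → Fin n → ℤ) → Edge m n → Bool
  asmIncrement A (vertical i j)   = partial false (λ i → A i (opposite j)) i
  asmIncrement A (horizontal i j) = partial false (λ j → A i (opposite j)) j

  module _ (A : PartialASM m n) where

    open PartialASM A

    asm-vertical : ∀ i j → entry i (opposite j) ≡
      δ (asmIncrement entry (vertical (inject₁ i) j)) (asmIncrement entry (vertical (suc i) j))
    asm-vertical i j = partial-rises false (column (opposite j)) (λ i → entry-range i (opposite j))
      (column-alternates (opposite j)) (column-first (opposite j)) i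

    asm-horizontal : ∀ i j → entry i (opposite j) ≡
      δ (asmIncrement entry (horizontal i (inject₁ j))) (asmIncrement entry (horizontal i (suc j)))
    asm-horizontal i = partial-rises false (row i ∘ opposite) (λ j → entry-range i (opposite j))
      (alternates-opposite (row i) (row-alternates i)) (last⇒first-opposite (row i) (row-last i))

    asm⇒increments : Increments m n
    asm⇒increments = record
      { increment = asmIncrement entry
      ; top       = λ _ → refl
      ; left      = λ _ → refl
      ; balance   = λ i j → δ-balance _ (asmIncrement entry (vertical (suc i) j))
          (asmIncrement entry (horizontal i (inject₁ j))) _
          (trans (sym (asm-vertical i j)) (asm-horizontal i j))
      }

  asm-injective : ∀ (A A′ : PartialASM m n) → let open PartialASM in
    (∀ e → asmIncrement (entry A) e ≡ asmIncrement (entry A′) e) → ∀ i j →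
      entry A i j ≡ entry A′ i j
  asm-injective A A′ eq i j = subst (λ j → entry A i j ≡ entry A′ i j) (Fin.opposite-involutive j)
    (trans (asm-vertical A i (opposite j))
      (trans (cong₂ δ (eq (vertical (inject₁ i) (opposite j))) (eq (vertical (suc i) (opposite j))))
      (sym (asm-vertical A′ i (opposite j)))))
    where open PartialASM

  module _ (X : Increments m n) where

    open Increments X

    private
      A : Fin m → Fin n → ℤ
      A i j = δ (increment (vertical (inject₁ i) (opposite j)))
        (increment (vertical (suc i) (opposite j)))

      A-horizontal : ∀ i j →
        A i j ≡ δ (increment (horizontal i (inject₁ (opposite j))))
        (increment (horizontal i (suc (opposite j))))
      A-horizontal i j = balance-δ _ (increment (vertical (suc i) (opposite j)))
        (increment (horizontal i (inject₁ (opposite j)))) _ (balance i (opposite j))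

      columnPath : Fin n → Fin (suc m) → Bool
      columnPath j i = increment (vertical i (opposite j))

      rowPath : Fin m → Fin (suc n) → Bool
      rowPath i j = increment (horizontal i (opposite j))

      column-rises : ∀ j → Rises (λ i → A i j) (columnPath j)
      column-rises j i = refl

      row-falls : ∀ i → Falls (A i) (rowPath i)
      row-falls i j = trans (A-horizontal i j)
        (cong₂ (λ a b → δ (increment (horizontal i a)) (increment (horizontal i b))) refl
          (sym (opposite-inject₁ j)))

      row-end : ∀ i → increment (horizontal i (opposite (fromℕ n))) ≡ false
      row-end i = trans (cong (increment ∘ horizontal i) (opposite-last n)) (left i)

      0or1 : ∀ {x} y → x ≡ δ false y → (x ≡ 0ℤ) ⊎ (x ≡ 1ℤ)
      0or1 y eq = subst (λ x → (x ≡ 0ℤ) ⊎ (x ≡ 1ℤ)) (sym eq) (δ-false y)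

    increments⇒asm : ∃ λ (M : PartialASM m n) → ∀ e → asmIncrement (PartialASM.entry M) e ≡
      increment e
    increments⇒asm = record
      { entry             = A
      ; entry-range       = λ i j → δ-range (increment (vertical (inject₁ i) (opposite j)))
          (increment (vertical (suc i) (opposite j)))
      ; row-sum           = λ i → 0or1 (increment (horizontal i (opposite zero)))
          (trans (sum-falls (A i) (rowPath i) (row-falls i))
            (cong (λ x → δ x (rowPath i zero)) (row-end i)))
      ; column-sum        = λ j → 0or1 (increment (vertical (fromℕ m) (opposite j)))
          (trans (sum-rises (λ i → A i j) (columnPath j) (column-rises j))
            (cong (λ x → δ x (columnPath j (fromℕ m))) (top (opposite j))))
      ; row-alternates    = λ i → falls⇒alternates (A i) (rowPath i) (row-falls i)
      ; column-alternates = λ j → rises⇒alternates (λ i → A i j) (columnPath j) (column-rises j)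
      ; column-first      = λ j → rises⇒first (λ i → A i j) (columnPath j) (column-rises j)
          (top (opposite j))
      ; row-last          = λ i → falls⇒last (A i) (rowPath i) (row-falls i) (row-end i)
      } , λ where
        (vertical i j)   →
          partial-unique false (λ i → A i (opposite j)) (λ i → increment (vertical i j))
          (λ i → cong
            (λ j → δ (increment (vertical (inject₁ i) j)) (increment (vertical (suc i) j)))
            (Fin.opposite-involutive j))
          (top j) i
        (horizontal i j) → partial-unique false (A i ∘ opposite) (λ j → increment (horizontal i j))
          (λ j → trans (A-horizontal i (opposite j))
            (cong (λ j →
              δ (increment (horizontal i (inject₁ j))) (increment (horizontal i (suc j))))
              (Fin.opposite-involutive j)))
          (left i) j

asm↔increments : ∀ m n → Bijection (partialASMs m n) (increments m n)
asm↔increments m n = bijection asm⇒increments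
  (λ where
    A≈A′ (vertical i j)   → partial-cong false (λ _ → A≈A′ _) i
    A≈A′ (horizontal i j) → partial-cong false (λ _ → A≈A′ _) j)
  (λ {A} {A′} eq → uncurry (asm-injective A A′ eq))
  increments⇒asm

-- Lattice paths

data Entry : Set where
  west north : Entry

data Exit : Set where
  south east : Exit

entryAfter : Exit → Entry
entryAfter south = north
entryAfter east  = west

entryAfter-injective : ∀ {x y} → entryAfter x ≡ entryAfter y → x ≡ y
entryAfter-injective {south} {south} _ = refl
entryAfter-injective {east}  {east}  _ = refl

last-++ : ∀ {A : Set} (xs : List A) {y ys} → last (xs ++ y ∷ ys) ≡ last (y ∷ ys)
last-++ []           = refl
last-++ (x ∷ [])     = refl
last-++ (x ∷ y ∷ xs) = last-++ (y ∷ xs)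

Linked-++ʳ : ∀ {A : Set} {R : A → A → Set} xs {ys} → Linked R (xs ++ ys) → Linked R ys
Linked-++ʳ []       l = l
Linked-++ʳ (x ∷ xs) l = Linked-++ʳ xs (Linked.tail l)

module _ {m n : ℕ} where

  private
    V : Set
    V = GridVertex {m} {n}

  Walk : List V → Set
  Walk = Linked Step

  Move : Exit → V → V → Set
  Move south = SouthStep
  Move east  = EastStep

  Enters : Entry → List V → V → Set
  Enters west  = EntersFromWest
  Enters north = EntersFromNorth

  Leaves : Exit → List V → V → Set
  Leaves south = LeavesToSouth
  Leaves east  = LeavesToEast

  step⇒move : ∀ {u v : V} → Step u v → ∃ λ x → Move x u v
  step⇒move (inj₁ s) = south , s
  step⇒move (inj₂ s) = east , s

  move⇒step : ∀ x {u v : V} → Move x u v → Step u v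
  move⇒step south = inj₁
  move⇒step east  = inj₂

  -- Also the measure on which following a flow, forwards or backwards, terminates.
  diagonal : V → ℕ
  diagonal (r , c) = toℕ r + toℕ c

  move-diagonal : ∀ x {u v} → Move x u v → diagonal v ≡ suc (diagonal u)
  move-diagonal south {r , c} (eq , refl) = cong (_+ toℕ c) eq
  move-diagonal east  {r , c} (refl , eq) = trans (cong (toℕ r +_) eq) (ℕ.+-suc (toℕ r) (toℕ c))

  step-diagonal : ∀ {u v} → Step u v → diagonal v ≡ suc (diagonal u)
  step-diagonal s = let (x , mv) = step⇒move s in move-diagonal x mv

  move-functional : ∀ x {u v w} → Move x u v → Move x u w → v ≡ w
  move-functional south (p , refl) (q , refl) = cong (_, _) (Fin.toℕ-injective (trans p (sym q)))
  move-functional east  (refl , p) (refl , q) = cong (_ ,_) (Fin.toℕ-injective (trans p (sym q)))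

  move-injective : ∀ x {u v w} → Move x u w → Move x v w → u ≡ v
  move-injective south (p , refl) (q , refl) =
    cong (_, _) (Fin.toℕ-injective (ℕ.suc-injective (trans (sym p) q)))
  move-injective east  (refl , p) (refl , q) =
    cong (_ ,_) (Fin.toℕ-injective (ℕ.suc-injective (trans (sym p) q)))

  move-direction : ∀ x y {u v} → Move x u v → Move y u v → x ≡ y
  move-direction south south _          _          = refl
  move-direction east  east  _          _          = refl
  move-direction south east  (eq , _)   (refl , _) = contradiction (sym eq) ℕ.1+n≢n
  move-direction east  south (_ , eq)   (_ , refl) = contradiction (sym eq) ℕ.1+n≢n

  diagonal-< : ∀ {x} xs {u ys} → Walk (x ∷ xs ++ u ∷ ys) → diagonal x < diagonal u
  diagonal-< []       (s ∷ _) = ℕ.≤-reflexive (sym (step-diagonal s))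
  diagonal-< (y ∷ xs) (s ∷ l) = ℕ.<-trans (ℕ.≤-reflexive (sym (step-diagonal s))) (diagonal-< xs l)

  diagonal-last : ∀ {x v} xs → Walk (x ∷ xs) → last (x ∷ xs) ≡ just v → diagonal x ≤ diagonal v
  diagonal-last []       _       refl = ℕ.≤-refl
  diagonal-last (y ∷ xs) (s ∷ l) eq   = ℕ.≤-trans (ℕ.n≤1+n _)
    (ℕ.≤-trans (ℕ.≤-reflexive (sym (step-diagonal s))) (diagonal-last xs l eq))

  -- each step leads to the next antidiagonal, so a path meets every antidiagonal at most once

  split-unique : ∀ xs xs′ {u u′ ys ys′} → Walk (xs ++ u ∷ ys) → xs ++ u ∷ ys ≡ xs′ ++ u′ ∷ ys′ →
    diagonal u ≡ diagonal u′ → xs ≡ xs′ × u ≡ u′ × ys ≡ ys′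
  split-unique []       []         l refl _    = refl , refl , refl
  split-unique []       (x′ ∷ xs′) l refl same = contradiction same (ℕ.<⇒≢ (diagonal-< xs′ l))
  split-unique (x ∷ xs) []         l refl same = contradiction (sym same) (ℕ.<⇒≢ (diagonal-< xs l))
  split-unique (x ∷ xs) (x′ ∷ xs′) l eq   same with ∷-injective eq
  ... | refl , eq′ with split-unique xs xs′ (Linked.tail l) eq′ same
  ... | refl , refl , refl = refl , refl , refl

  hasStep⇒step : ∀ {p u v} → Walk p → HasStep p u v → Step u v
  hasStep⇒step l (xs , ys , refl) = Linked.head (Linked-++ʳ xs l)

  predecessor-unique : ∀ {p u u′ v} → Walk p → HasStep p u v → HasStep p u′ v → u ≡ u′
  predecessor-unique l s@(xs , ys , refl) s′@(xs′ , ys′ , eq) =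
    proj₁ (proj₂ (split-unique xs xs′ l eq
    (ℕ.suc-injective
      (trans (sym (step-diagonal (hasStep⇒step l s))) (step-diagonal (hasStep⇒step l s′))))))

  successor-unique : ∀ {p u v v′} → Walk p → HasStep p u v → HasStep p u v′ → v ≡ v′
  successor-unique l (xs , ys , refl) (xs′ , ys′ , eq) with split-unique xs xs′ l eq refl
  ... | _ , _ , refl = refl

  no-step-into-start : ∀ {p u v} → Walk p → StartsAt p v → ¬ HasStep p u v
  no-step-into-start l starts s@([]     , ys , refl) with refl ← just-injective starts =
    ℕ.1+n≢n (sym (step-diagonal (hasStep⇒step l s)))
  no-step-into-start l starts s@(x ∷ xs , ys , refl) with refl ← just-injective starts =
    ℕ.<-asym (diagonal-< xs l) (ℕ.≤-reflexive (sym (step-diagonal (hasStep⇒step l s))))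

  no-step-from-end : ∀ {p u v} → Walk p → EndsAt p u → ¬ HasStep p u v
  no-step-from-end {u = u} l ends s@(xs , ys , refl) = ℕ.<⇒≱
    (ℕ.≤-reflexive (sym (step-diagonal (hasStep⇒step l s))))
    (diagonal-last ys (Linked.tail (Linked-++ʳ xs l)) (trans (sym (last-++ xs)) ends))

  -- A walk has at most one predecessor of a vertex, and none at its start.
  enters-unique : ∀ {p v} d d′ → Walk p → Enters d p v → Enters d′ p v → d ≡ d′
  enters-unique west  west  l _ _ = refl
  enters-unique north north l _ _ = refl
  enters-unique west  north l w nn = ⊥-elim (west-north l w nn)
    where
    west-north : ∀ {p v} → Walk p → Enters west p v → ¬ Enters north p v
    west-north l (inj₁ starts)    (_ , _ , s)   = no-step-into-start l starts s
    west-north l (inj₂ (u , e , s)) (u′ , e′ , s′) with refl ← predecessor-unique l s s′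
      with () ← move-direction east south e e′
  enters-unique north west  l nn w = sym (enters-unique west north l w nn)

  leaves-unique : ∀ {p v} x x′ → Walk p → Leaves x p v → Leaves x′ p v → x ≡ x′
  leaves-unique south south l _ _ = refl
  leaves-unique east  east  l _ _ = refl
  leaves-unique south east  l s e = ⊥-elim (south-east l s e)
    where
    south-east : ∀ {p v} → Walk p → Leaves south p v → ¬ Leaves east p v
    south-east l (inj₁ ends)         (_ , _ , s)    = no-step-from-end l ends s
    south-east l (inj₂ (w , e , s)) (w′ , e′ , s′) with refl ← successor-unique l s s′
      with () ← move-direction south east e e′
  leaves-unique east  south l e s = sym (leaves-unique south east l s e)

  hasStep⇒∈ˡ : ∀ {p : List V} {u v : V} → HasStep p u v → u ∈ p
  hasStep⇒∈ˡ (xs , ys , refl) = ∈-insert xs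

  hasStep⇒∈ʳ : ∀ {p : List V} {u v : V} → HasStep p u v → v ∈ p
  hasStep⇒∈ʳ {u = u} {v} (xs , ys , refl) =
    subst (v ∈_) (++-assoc xs (u ∷ []) (v ∷ ys)) (∈-insert (xs ++ u ∷ []))

  starts⇒∈ : ∀ {p} {v : V} → StartsAt p v → v ∈ p
  starts⇒∈ {x ∷ p} refl = here refl

  ends⇒∈ : ∀ {p} {v : V} → EndsAt p v → v ∈ p
  ends⇒∈ {x ∷ []}    refl = here refl
  ends⇒∈ {x ∷ y ∷ p} ends = there (ends⇒∈ ends)

  enters⇒∈ : ∀ d {p v} → Enters d p v → v ∈ p
  enters⇒∈ west  (inj₁ starts)      = starts⇒∈ starts
  enters⇒∈ west  (inj₂ (_ , _ , s)) = hasStep⇒∈ʳ s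
  enters⇒∈ north (_ , _ , s)        = hasStep⇒∈ʳ s

  leaves⇒∈ : ∀ x {p v} → Leaves x p v → v ∈ p
  leaves⇒∈ south (inj₁ ends)        = ends⇒∈ ends
  leaves⇒∈ south (inj₂ (_ , _ , s)) = hasStep⇒∈ˡ s
  leaves⇒∈ east  (_ , _ , s)        = hasStep⇒∈ˡ s

  move⇒enters : ∀ x {p u v} → Move x u v → HasStep p u v → Enters (entryAfter x) p v
  move⇒enters south mv s = _ , mv , s
  move⇒enters east  mv s = inj₂ (_ , mv , s)

  move⇒leaves : ∀ x {p u v} → Move x u v → HasStep p u v → Leaves x p u
  move⇒leaves south mv s = inj₂ (_ , mv , s)
  move⇒leaves east  mv s = _ , mv , s

  ∈⇒enters : ∀ {p v} → Walk p → v ∈ p → ∃ λ d → Enters d p v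
  ∈⇒enters {p} {v} l v∈p with ∈-∃++ v∈p
  ... | xs , ys , refl with initLast xs
  ... | []       = west , inj₁ refl
  ... | zs ∷ʳ′ u = let (x , mv) = step⇒move (hasStep⇒step l s) in entryAfter x , move⇒enters x mv s
    where
    s : HasStep ((zs ∷ʳ u) ++ v ∷ ys) u v
    s = zs , ys , ++-assoc zs (u ∷ []) (v ∷ ys)

  ∈⇒leaves : ∀ {p v} → Walk p → v ∈ p → ∃ λ x → Leaves x p v
  ∈⇒leaves {p} {v} l v∈p with ∈-∃++ v∈p
  ... | xs , []     , refl = south , inj₁ (last-++ xs)
  ... | xs , w ∷ ys , refl = let (x , mv) = step⇒move (hasStep⇒step l s) in x , move⇒leaves x mv s
    where
    s : HasStep (xs ++ v ∷ w ∷ ys) v w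
    s = xs , ys , refl

  _≟V_ : (u v : V) → Dec (u ≡ v)
  _≟V_ = Product.≡-dec Fin._≟_ Fin._≟_

  hasStep? : ∀ p u v → Dec (HasStep p u v)
  hasStep? []          u v = no λ { ([] , _ , ()) ; (_ ∷ _ , _ , ()) }
  hasStep? (x ∷ [])    u v = no λ { ([] , _ , ()) ; (_ ∷ [] , _ , ()) ; (_ ∷ _ ∷ _ , _ , ()) }
  hasStep? (x ∷ y ∷ p) u v = map′
    (λ where
      (inj₁ (refl , refl))    → [] , p , refl
      (inj₂ (xs , ys , eq)) → x ∷ xs , ys , cong (x ∷_) eq)
    (λ where
      ([] , ys , refl)     → inj₁ (refl , refl)
      (_ ∷ xs , ys , eq) → inj₂ (xs , ys , proj₂ (∷-injective eq)))
    (((x ≟V u) ×-dec (y ≟V v)) ⊎-dec hasStep? (y ∷ p) u v)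

  move? : ∀ x u v → Dec (Move x u v)
  move? south (r , c) (r′ , c′) = (toℕ r′ ℕ.≟ suc (toℕ r)) ×-dec (c′ Fin.≟ c)
  move? east  (r , c) (r′ , c′) = (r′ Fin.≟ r) ×-dec (toℕ c′ ℕ.≟ suc (toℕ c))

  startsAt? : ∀ p v → Dec (StartsAt p v)
  startsAt? p v = Maybe.≡-dec _≟V_ (head p) (just v)

  private
    moves? : ∀ x p v → Dec (∃ λ w → Move x v w × HasStep p v w)
    moves? x p v = map′ (λ (r , c , h) → (r , c) , h) (λ ((r , c) , h) → r , c , h)
      (Fin.any? λ r → Fin.any? λ c → move? x v (r , c) ×-dec hasStep? p v (r , c))

  leaves? : ∀ x p v → Dec (Leaves x p v)
  leaves? south p v = Maybe.≡-dec _≟V_ (last p) (just v) ⊎-dec moves? south p v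
  leaves? east  p v = moves? east p v

-- Nests of osculating paths

-- The edges that a nest of osculating paths runs along, including those by which
-- its paths enter at the left and leave at the bottom.

record Flow (m n : ℕ) : Set where
  field
    used     : Edge m n → Bool
    top      : ∀ j → used (vertical zero j) ≡ false
    right    : ∀ i → used (horizontal i (fromℕ n)) ≡ false
    conserve : ∀ i j →
      bit (used (vertical (inject₁ i) j)) + bit (used (horizontal i (inject₁ j))) ≡
      bit (used (vertical (suc i) j)) + bit (used (horizontal i (suc j)))

flows : ℕ → ℕ → Setoid 0ℓ 0ℓ
flows m n = pointwise {Flow m n} Flow.used

mirror : ∀ {m n} → Edge m n → Edge m n
mirror (vertical i j)   = vertical i (opposite j)
mirror (horizontal i j) = horizontal i (opposite j)

mirror-involutive : ∀ {m n} (e : Edge m n) → mirror (mirror e) ≡ e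
mirror-involutive (vertical i j)   = cong (vertical i) (Fin.opposite-involutive j)
mirror-involutive (horizontal i j) = cong (horizontal i) (Fin.opposite-involutive j)

flow↔increments : ∀ m n → Bijection (flows m n) (increments m n)
flow↔increments m n = bijection flow⇒increments
  (λ F≈F′ e → F≈F′ (mirror e))
  (λ {F} {F′} eq e → subst (λ e → Flow.used F e ≡ Flow.used F′ e) (mirror-involutive e)
    (eq (mirror e)))
  (λ X → increments⇒flow X , λ e → cong (Increments.increment X) (mirror-involutive e))
  where
  flow⇒increments : Flow m n → Increments m n
  flow⇒increments F = record
    { increment = used ∘ mirror
    ; top       = top ∘ opposite
    ; left      = right
    ; balance   = λ i j → trans (conserve i (opposite j))
        (cong (λ k → bit (used (vertical (suc i) (opposite j))) + bit (used (horizontal i k)))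
          (sym (opposite-inject₁ j)))
    }
    where open Flow F
  increments⇒flow : Increments m n → Flow m n
  increments⇒flow X = record
    { used     = increment ∘ mirror
    ; top      = top ∘ opposite
    ; right    = λ i → trans (cong (increment ∘ horizontal i) (opposite-last n)) (left i)
    ; conserve = λ i j → trans
        (cong (λ k → bit (increment (vertical (inject₁ i) (opposite j))) + bit
          (increment (horizontal i k))) (opposite-inject₁ j))
        (balance i (opposite j))
    }
    where open Increments X

-- The osculating rule: a path turns whenever the edge for turning is in use, and goes straight on
-- only otherwise. With all four edges in use, two paths touch without crossing.
turn : Entry → Bool → Bool → Exit
turn west  s e = if s then south else east
turn north s e = if e then east else south

leaving : Exit → Bool → Bool → Bool
leaving south s e = s
leaving east  s e = e

entering : Entry → Bool → Bool → Bool
entering north n w = n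
entering west  n w = w

turn-leaves : ∀ d n w s e → bit n + bit w ≡ bit s + bit e → T (entering d n w) →
  T (leaving (turn d s e) s e)
turn-leaves west  n     true true  e     _ _ = _
turn-leaves west  n     true false true  _ _ = _
turn-leaves west  false true false false () _
turn-leaves west  true  true false false () _
turn-leaves north true  w    s     true  _ _ = _
turn-leaves north true  w    true  false _ _ = _
turn-leaves north true  false false false () _
turn-leaves north true  true  false false () _

-- By conservation, turning matches the used in-edges with the used out-edges one to one. That every
-- used out-edge is hit allows a path to be followed backwards.
turn-onto : ∀ x n w s e → bit n + bit w ≡ bit s + bit e → T (leaving x s e) →
  ∃ λ d → T (entering d n w) × turn d s e ≡ x
turn-onto south n     true  true  e     _ _ = west , _ , refl
turn-onto south true  false true  false _ _ = north , _ , refl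
turn-onto south false false true  e     () _
turn-onto south true  false true  true  () _
turn-onto east  true  w     s     true  _ _ = north , _ , refl
turn-onto east  false true  false true  _ _ = west , _ , refl
turn-onto east  false true  true  true  () _
turn-onto east  false false false true  () _
turn-onto east  false false true  true  () _

turn-both : ∀ n w s e → bit n + bit w ≡ bit s + bit e → T n → T w →
  turn west s e ≡ south × turn north s e ≡ east
turn-both true true true  true  _  _ _ = refl , refl
turn-both true true true  false () _ _
turn-both true true false false () _ _

module _ {m n : ℕ} where

  private
    V : Set
    V = GridVertex {m} {n}

  inEdge : Entry → V → Edge m n
  inEdge west  (r , c) = horizontal r (inject₁ c)
  inEdge north (r , c) = vertical (inject₁ r) c

  outEdge : Exit → V → Edge m n
  outEdge south (r , c) = vertical (suc r) c
  outEdge east  (r , c) = horizontal r (suc c)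

  outEdge≡inEdge : ∀ x {u v} → Move x u v → outEdge x u ≡ inEdge (entryAfter x) v
  outEdge≡inEdge south {r , c} {r′ , _} (eq , refl) =
    cong (λ a → vertical a c) (Fin.toℕ-injective (sym (trans (Fin.toℕ-inject₁ r′) eq)))
  outEdge≡inEdge east {r , c} {_ , c′} (refl , eq) =
    cong (horizontal r) (Fin.toℕ-injective (sym (trans (Fin.toℕ-inject₁ c′) eq)))

  move-south : ∀ (v : V) → suc (toℕ (proj₁ v)) ≡ m ⊎ ∃ λ w → Move south v w
  move-south (r , c) with ℕ.m≤n⇒m<n∨m≡n (Fin.toℕ<n r)
  ... | inj₁ r+1<m = inj₂ ((fromℕ< r+1<m , c) , Fin.toℕ-fromℕ< r+1<m , refl)
  ... | inj₂ last  = inj₁ last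

  move-east : ∀ (v : V) → suc (proj₂ v) ≡ fromℕ n ⊎ ∃ λ w → Move east v w
  move-east (r , c) with ℕ.m≤n⇒m<n∨m≡n (Fin.toℕ<n c)
  ... | inj₁ c+1<n = inj₂ ((r , fromℕ< c+1<n) , refl , Fin.toℕ-fromℕ< c+1<n)
  ... | inj₂ last  = inj₁ (Fin.toℕ-injective (trans last (sym (Fin.toℕ-fromℕ n))))

  no-move-south : ∀ {v w : V} → suc (toℕ (proj₁ v)) ≡ m → ¬ Move south v w
  no-move-south {w = r , _} last (eq , _) = ℕ.<⇒≢ (Fin.toℕ<n r) (trans eq last)

  module _ (f : Edge m n → Bool) where

    exit : Entry → V → Exit
    exit d v = turn d (f (outEdge south v)) (f (outEdge east v))

    -- Trace d v ps: the path that enters v by d and continues along f is v ∷ ps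

    data Trace : Entry → V → List V → Set where
      stop : ∀ {d v} → exit d v ≡ south → suc (toℕ (proj₁ v)) ≡ m → Trace d v []
      move : ∀ {d v w ps} x → exit d v ≡ x → Move x v w → Trace (entryAfter x) w ps →
        Trace d v (w ∷ ps)

    trace-unique : ∀ {d v ps qs} → Trace d v ps → Trace d v qs → ps ≡ qs
    trace-unique (stop _ _)        (stop _ _)         = refl
    trace-unique (stop eq bottom)     (move x eq′ mv _) with refl ← trans (sym eq) eq′ =
      contradiction mv (no-move-south bottom)
    trace-unique (move x eq′ mv _) (stop eq bottom)     with refl ← trans (sym eq) eq′ =
      contradiction mv (no-move-south bottom)
    trace-unique (move x eq mv t)  (move x′ eq′ mv′ t′)
      with refl ← trans (sym eq) eq′
      with refl ← move-functional x mv mv′ = cong (_ ∷_) (trace-unique t t′)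

    trace-walk : ∀ {d v ps} → Trace d v ps → Walk (v ∷ ps)
    trace-walk (stop _ _)      = [-]
    trace-walk (move x _ mv t) = move⇒step x mv ∷ trace-walk t

    trace-end : ∀ {d v ps} → Trace d v ps → ∃ λ w → EndsAt (v ∷ ps) w × suc (toℕ (proj₁ w)) ≡ m
    trace-end {v = v} (stop _ bottom) = v , refl , bottom
    trace-end (move _ _ _ t)       = trace-end t

    -- Visits s xs d v: the path that enters s from the west and continues along f
    -- runs through xs, listed backwards, and then enters v by d

    data Visits (s : V) : List V → Entry → V → Set where
      start : Visits s [] west s
      move  : ∀ {xs d v w} x → Visits s xs d v → exit d v ≡ x → Move x v w →
        Visits s (v ∷ xs) (entryAfter x) w

    -- `Visits` and `Trace` form a zipper focused on one vertex; moving the focus back to the start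
    -- leaves a trace of the whole path.
    unwind : ∀ {s xs d v ps} → Visits s xs d v → Trace d v ps →
      ∃ λ qs → s ∷ qs ≡ xs ʳ++ (v ∷ ps) × Trace west s qs
    unwind start              t = _ , refl , t
    unwind (move x vis eq mv) t = unwind vis (move x eq mv t)

    visit : ∀ {s xs d v ps w} → Visits s xs d v → Trace d v ps → w ∈ v ∷ ps →
      ∃ λ ys → ∃ λ d′ → Visits s ys d′ w
    visit vis t                 (here refl) = _ , _ , vis
    visit vis (move x eq mv t)  (there w∈)  = visit (move x vis eq mv) t w∈

    visit-step : ∀ {s xs d a ps u v} zs {ys} → Visits s xs d a → Trace d a ps →
      a ∷ ps ≡ zs ++ u ∷ v ∷ ys →
      ∃₂ λ ys d′ → ∃ λ x → Visits s ys d′ u × exit d′ u ≡ x × Move x u v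
    visit-step []       vis (move x eq mv t) refl = _ , _ , x , vis , eq , mv
    visit-step []       vis (stop _ _)       ()
    visit-step (z ∷ zs) vis (move x eq mv t) e    =
      visit-step zs (move x vis eq mv) t (proj₂ (∷-injective e))
    visit-step (z ∷ []) vis (stop _ _)       ()
    visit-step (z ∷ _ ∷ _) vis (stop _ _)    ()

    visit-end : ∀ {s xs d a ps v} → Visits s xs d a → Trace d a ps → EndsAt (a ∷ ps) v →
      ∃₂ λ ys d′ → Visits s ys d′ v × exit d′ v ≡ south
    visit-end vis (stop eq _)      refl = _ , _ , vis , eq
    visit-end vis (move x eq mv t) ends = visit-end (move x vis eq mv) t ends

    visits⇒enters : ∀ {s xs d v ps p} → Visits s xs d v → p ≡ xs ʳ++ (v ∷ ps) → Enters d p v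
    visits⇒enters start refl = inj₁ refl
    visits⇒enters {ps = ps} (move {xs} {v = u} {w} x vis eq mv) refl =
      move⇒enters x mv (reverse xs , ps , ʳ++-defn xs)

    trace⇒leaves : ∀ {d v ps p} xs x → exit d v ≡ x → Trace d v ps → p ≡ xs ʳ++ (v ∷ ps) →
      Leaves x p v
    trace⇒leaves {v = v} xs x eq (stop eq′ _) refl with refl ← trans (sym eq) eq′ =
      inj₁ (trans (cong last (ʳ++-defn xs)) (last-++ (reverse xs)))
    trace⇒leaves {v = v} {w ∷ ps} xs x eq (move x′ eq′ mv _) refl with refl ← trans (sym eq) eq′ =
      move⇒leaves x mv (reverse xs , ps , ʳ++-defn xs)

  module _ (F : Flow m n) where

    open Flow F

    exit-used : ∀ d v → T (used (inEdge d v)) → T (used (outEdge (exit used d v) v))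
    exit-used d v@(r , c) t = leaving⇒used (exit used d v) (turn-leaves d _ _
      (used (outEdge south v)) (used (outEdge east v)) (conserve r c) (used⇒entering d t))
      where
      used⇒entering : ∀ d → T (used (inEdge d v)) →
        T (entering d (used (inEdge north v)) (used (inEdge west v)))
      used⇒entering west  t = t
      used⇒entering north t = t
      leaving⇒used : ∀ x → T (leaving x (used (outEdge south v)) (used (outEdge east v))) →
        T (used (outEdge x v))
      leaving⇒used south t = t
      leaving⇒used east  t = t

    exit-onto : ∀ x v → T (used (outEdge x v)) → ∃ λ d → T (used (inEdge d v)) × exit used d v ≡ x
    exit-onto x v@(r , c) t with turn-onto x (used (inEdge north v)) (used (inEdge west v))
      (used (outEdge south v)) (used (outEdge east v)) (conserve r c) (used⇒leaving x t)
      where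
      used⇒leaving : ∀ x → T (used (outEdge x v)) →
        T (leaving x (used (outEdge south v)) (used (outEdge east v)))
      used⇒leaving south t = t
      used⇒leaving east  t = t
    ... | west  , t′ , eq = west , t′ , eq
    ... | north , t′ , eq = north , t′ , eq

    exit-both : ∀ v → T (used (inEdge north v)) → T (used (inEdge west v)) →
      exit used west v ≡ south × exit used north v ≡ east
    exit-both v@(r , c) = turn-both (used (inEdge north v)) (used (inEdge west v))
      (used (outEdge south v)) (used (outEdge east v)) (conserve r c)

    exit-injective : ∀ d d′ v → T (used (inEdge d v)) → T (used (inEdge d′ v)) →
      exit used d v ≡ exit used d′ v → d ≡ d′
    exit-injective west  west  v _ _  _  = refl
    exit-injective north north v _ _  _  = refl
    exit-injective west  north v t t′ eq with exit-both v t′ t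
    ... | w , n with () ← trans (sym w) (trans eq n)
    exit-injective north west  v t t′ eq with exit-both v t t′
    ... | w , n with () ← trans (sym w) (trans (sym eq) n)

    trace : ∀ k d v → diagonal v + k ≡ m + n → T (used (inEdge d v)) → ∃ λ ps → Trace used d v ps
    trace zero d (r , c) eq t = contradiction (trans (sym (ℕ.+-identityʳ _)) eq)
      (ℕ.<⇒≢ (ℕ.+-mono-< (Fin.toℕ<n r) (Fin.toℕ<n c)))
    trace (suc k) d v eq t with exit used d v in x≡ | exit-used d v t
    ... | x | t′ = continue x x≡ t′
      where
      step : ∀ x {w} → exit used d v ≡ x → T (used (outEdge x v)) → Move x v w → ∃ λ ps →
        Trace used d v ps
      step x {w} x≡ t′ mv = let ps , tr = trace k (entryAfter x) w
                                  (trans (cong (_+ k) (move-diagonal x mv))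
                                    (trans (sym (ℕ.+-suc (diagonal v) k)) eq))
                                  (subst (T ∘ used) (outEdge≡inEdge x mv) t′)
                            in w ∷ ps , move x x≡ mv tr
      continue : ∀ x → exit used d v ≡ x → T (used (outEdge x v)) → ∃ λ ps → Trace used d v ps
      continue south x≡ t′ with move-south v
      ... | inj₁ bottom   = [] , stop x≡ bottom
      ... | inj₂ (w , mv) = step south x≡ t′ mv
      continue east  x≡ t′ with move-east v
      ... | inj₁ last     =
        ⊥-elim (subst T (right (proj₁ v)) (subst (T ∘ used ∘ horizontal (proj₁ v)) last t′))
      ... | inj₂ (w , mv) = step east x≡ t′ mv

    visits-used : ∀ {s xs d v} → T (used (inEdge west s)) → Visits used s xs d v →
      T (used (inEdge d v))
    visits-used t start                       = t
    visits-used t (move {d = d} {v} x vis refl mv) =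
      subst (T ∘ used) (outEdge≡inEdge x mv) (exit-used d v (visits-used t vis))

    -- followed backwards, f leaves no choice either

    visits-merge : ∀ {s s′ xs xs′ d d′ v v′} → toℕ (proj₂ s) ≡ 0 → toℕ (proj₂ s′) ≡ 0 →
      T (used (inEdge west s)) → T (used (inEdge west s′)) →
      Visits used s xs d v → Visits used s′ xs′ d′ v′ → d ≡ d′ → v ≡ v′ → s ≡ s′
    visits-merge s₀ s′₀ t t′ start start _ refl = refl
    visits-merge s₀ s′₀ t t′ start (move east _ _ (_ , eq)) _ refl =
      contradiction (trans (sym s₀) eq) λ ()
    visits-merge s₀ s′₀ t t′ (move east _ _ (_ , eq)) start _ refl =
      contradiction (trans (sym s′₀) eq) λ ()
    visits-merge s₀ s′₀ t t′ (move {v = v} x vis eq mv) (move x′ vis′ eq′ mv′) d≡d′ refl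
      with refl ← entryAfter-injective d≡d′
      with refl ← move-injective x mv mv′ = visits-merge s₀ s′₀ t t′ vis vis′
        (exit-injective _ _ v (visits-used t vis) (visits-used t′ vis′) (trans eq (sym eq′))) refl

module _ {m n-1 : ℕ} where

  private
    n : ℕ
    n = suc n-1
    V : Set
    V = GridVertex {m} {n}

  leftEnd : Fin m → V
  leftEnd r = r , zero

  -- Every edge with an upper or left vertex in the grid is charged to that vertex. The bottom
  -- border is thereby included, as ending counts as leaving to the south; an edge of the left
  -- border is charged to the start.
  Uses : List V → Edge m n → Set
  Uses p (vertical zero c)      = ⊥
  Uses p (vertical (suc r) c)   = Leaves south p (r , c)
  Uses p (horizontal r zero)    = StartsAt p (leftEnd r)
  Uses p (horizontal r (suc c)) = Leaves east p (r , c)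

  uses? : ∀ p e → Dec (Uses p e)
  uses? p (vertical zero c)      = no λ ()
  uses? p (vertical (suc r) c)   = leaves? south p (r , c)
  uses? p (horizontal r zero)    = startsAt? p (leftEnd r)
  uses? p (horizontal r (suc c)) = leaves? east p (r , c)

  leaves⇒uses : ∀ x {p v} → Leaves x p v → Uses p (outEdge x v)
  leaves⇒uses south = id
  leaves⇒uses east  = id

  predecessor : ∀ d (v : V) → (∃ λ r → d ≡ west × v ≡ leftEnd r) ⊎
    (∃ λ c → d ≡ north × inEdge d v ≡ vertical zero c) ⊎
    (∃₂ λ x u → d ≡ entryAfter x × Move x u v)
  predecessor west  (r , zero)  = inj₁ (r , refl , refl)
  predecessor west  (r , suc c) =
    inj₂ (inj₂ (east , (r , inject₁ c) , refl , refl , cong suc (sym (Fin.toℕ-inject₁ c))))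
  predecessor north (zero , c)  = inj₂ (inj₁ (c , refl , refl))
  predecessor north (suc r , c) =
    inj₂ (inj₂ (south , (inject₁ r , c) , refl , cong suc (sym (Fin.toℕ-inject₁ r)) , refl))

  -- From flows to nests

  module _ (F : Flow m n) where

    open Flow F

    top-unused : ∀ c → ¬ T (used (vertical zero c))
    top-unused c = subst T (top c)

    coverage : ∀ k d v → diagonal v ≡ k → T (used (inEdge d v)) →
      ∃₂ λ r xs → T (used (horizontal r zero)) × Visits used (leftEnd r) xs d v
    coverage k d v v≡k t with predecessor d v
    ... | inj₁ (r , refl , refl)        = r , [] , t , start
    ... | inj₂ (inj₁ (c , _ , eq))      = contradiction (subst (T ∘ used) eq t) (top-unused c)
    coverage zero d v v≡k t | inj₂ (inj₂ (x , u , refl , mv)) =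
      contradiction (trans (sym (move-diagonal x mv)) v≡k) λ ()
    coverage (suc k) d v v≡k t | inj₂ (inj₂ (x , u , refl , mv)) =
      let d′ , t′ , x≡ = exit-onto F x u (subst (T ∘ used) (sym (outEdge≡inEdge x mv)) t)
          r , xs , t₀ , vis =
            coverage k d′ u (ℕ.suc-injective (trans (sym (move-diagonal x mv)) v≡k)) t′
      in r , u ∷ xs , t₀ , move x vis x≡ mv

    traceFrom : ∀ d v → T (used (inEdge d v)) → ∃ λ ps → Trace used d v ps
    traceFrom d v@(r , c) = trace F (m + n ∸ diagonal v) d v
      (ℕ.m+[n∸m]≡n (ℕ.+-mono-≤ (ℕ.<⇒≤ (Fin.toℕ<n r)) (ℕ.<⇒≤ (Fin.toℕ<n c))))

    FlowPath : Fin m → List V → Set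
    FlowPath r p = T (used (horizontal r zero)) × ∃ λ qs →
      p ≡ leftEnd r ∷ qs × Trace used west (leftEnd r) qs

    pathsFrom : (r : Fin m) → Dec (T (used (horizontal r zero))) → List (List V)
    pathsFrom r (yes t) = (leftEnd r ∷ proj₁ (traceFrom west (leftEnd r) t)) ∷ []
    pathsFrom r (no _)  = []

    ∈-pathsFrom⇒flowPath : ∀ {r p} d → p ∈ pathsFrom r d → FlowPath r p
    ∈-pathsFrom⇒flowPath (yes t) (here refl) = t , _ , refl , proj₂ (traceFrom west _ t)

    flowPath⇒∈-pathsFrom : ∀ {r p} d → FlowPath r p → p ∈ pathsFrom r d
    flowPath⇒∈-pathsFrom (yes t) (_ , qs , refl , tr) =
      here (cong (_ ∷_) (trace-unique used tr (proj₂ (traceFrom west _ t))))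
    flowPath⇒∈-pathsFrom (no ¬t) (t , _) = contradiction t ¬t

    private
      row-paths : Fin m → List (List V)
      row-paths r = pathsFrom r (T? (used (horizontal r zero)))

    flowPaths : List (List V)
    flowPaths = concatMap row-paths (allFin m)

    ∈⇒flowPath : ∀ {p} → p ∈ flowPaths → ∃ λ r → FlowPath r p
    ∈⇒flowPath p∈ =
      let r , _ , p∈r = find (∈-concatMap⁻ row-paths {xs = allFin m} p∈)
      in r , ∈-pathsFrom⇒flowPath _ p∈r

    flowPath⇒∈ : ∀ {r p} → FlowPath r p → p ∈ flowPaths
    flowPath⇒∈ {r} P = ∈-concatMap⁺ row-paths (lose (∈-allFin r) (flowPath⇒∈-pathsFrom _ P))

    flowPath-unique : ∀ {r r′ p q} → FlowPath r p → FlowPath r′ q → leftEnd r ≡ leftEnd r′ → p ≡ q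
    flowPath-unique (_ , _ , refl , tr) (_ , _ , refl , tr′) refl =
      cong (_ ∷_) (trace-unique used tr tr′)

    flowPath-visit : ∀ {r p v} → FlowPath r p → v ∈ p → ∃ λ d → T (used (inEdge d v)) × ∃ λ xs →
      Visits used (leftEnd r) xs d v
    flowPath-visit (t , qs , refl , tr) v∈p =
      let xs , d , vis = visit used start tr v∈p
      in d , visits-used F t vis , xs , vis

    -- Backwards determinism gives the same start, and forwards determinism then gives the same
    -- path.
    flowPath-merge : ∀ {r r′ p q xs xs′ d v} → FlowPath r p → FlowPath r′ q →
      Visits used (leftEnd r) xs d v → Visits used (leftEnd r′) xs′ d v → p ≡ q
    flowPath-merge P@(t , _) Q@(t′ , _) vis vis′ =
      flowPath-unique P Q (visits-merge F refl refl t t′ vis vis′ refl refl)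

    -- Joins the backward path from `coverage` to the forward path from `traceFrom`.
    flowPath-through : ∀ d v → T (used (inEdge d v)) → ∃₂ λ r p → FlowPath r p ×
      (∃ λ xs → Visits used (leftEnd r) xs d v) × Enters d p v × Leaves (exit used d v) p v
    flowPath-through d v t =
      let r , xs , t₀ , vis = coverage (diagonal v) d v refl t
          ps , tr = traceFrom d v t
          qs , eq , tr₀ = unwind used vis tr
      in r , leftEnd r ∷ qs , (t₀ , qs , refl , tr₀) , (xs , vis) ,
         visits⇒enters used vis eq , trace⇒leaves used xs (exit used d v) refl tr eq

    flowPath-step : ∀ {r p v w} x → FlowPath r p → Move x v w → HasStep p v w →
      ∃₂ λ xs d → Visits used (leftEnd r) xs d v × exit used d v ≡ x
    flowPath-step x (_ , _ , refl , tr) mv (xs , ys , eq) =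
      let xs′ , d , x′ , vis , x≡ , mv′ = visit-step used xs start tr eq
      in xs′ , d , vis , trans x≡ (move-direction x′ x mv′ mv)

    flowPath-leaves : ∀ {r p} x v → FlowPath r p → Leaves x p v →
      ∃₂ λ xs d → Visits used (leftEnd r) xs d v × exit used d v ≡ x
    flowPath-leaves south v (_ , _ , refl , tr) (inj₁ ends) = visit-end used start tr ends
    flowPath-leaves south v P (inj₂ (w , mv , s)) = flowPath-step south P mv s
    flowPath-leaves east  v P (w , mv , s)        = flowPath-step east P mv s

    flow⇒nest : Nest m n
    flow⇒nest = record
      { paths          = flowPaths
      ; all-paths      = λ p p∈ → isPath (proj₂ (∈⇒flowPath p∈))
      ; no-shared-step = no-shared-step
      ; osculating     = λ v → osculating v (T? (used (inEdge west v))) (T? (used (inEdge north v)))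
      }
      where
      isPath : ∀ {r p} → FlowPath r p → IsPath p
      isPath {r} (_ , _ , refl , tr) = record
        { steps  = trace-walk used tr
        ; starts = leftEnd r , refl , refl
        ; ends   = trace-end used tr
        }
      no-shared-step : ∀ p q → p ∈ flowPaths → q ∈ flowPaths → p ≢ q → ∀ u v →
        ¬ (HasStep p u v × HasStep q u v)
      -- Paths sharing a step enter `v` by the same side, and so they merge.
      no-shared-step p q p∈ q∈ p≢q u v (s , s′) =
        let r , P = ∈⇒flowPath p∈
            r′ , Q = ∈⇒flowPath q∈
            x , mv = step⇒move (hasStep⇒step (IsPath.steps (isPath P)) s)
            xs , d , vis , x≡ = flowPath-leaves x u P (move⇒leaves x mv s)
            xs′ , d′ , vis′ , x≡′ = flowPath-leaves x u Q (move⇒leaves x mv s′)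
        in p≢q (flowPath-merge P Q (move x vis x≡ mv) (move x vis′ x≡′ mv))
      one : ∀ v → (∀ d d′ → T (used (inEdge d v)) → T (used (inEdge d′ v)) → d ≡ d′) →
        AtMostOnePasses flowPaths v
      one v same p q p∈ q∈ v∈p v∈q =
        let r , P = ∈⇒flowPath p∈
            r′ , Q = ∈⇒flowPath q∈
            d , t , xs , vis = flowPath-visit P v∈p
            d′ , t′ , xs′ , vis′ = flowPath-visit Q v∈q
        in flowPath-merge P Q vis
          (subst (λ d → Visits used (leftEnd r′) xs′ d v) (same d′ d t′ t) vis′)
      osculating : ∀ v → Dec (T (used (inEdge west v))) → Dec (T (used (inEdge north v))) →
        AtMostOnePasses flowPaths v ⊎ TwoTouch flowPaths v
      osculating v (no ¬w) _ = inj₁ (one v λ where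
        west  _     w _ → contradiction w ¬w
        _     west  _ w → contradiction w ¬w
        north north _ _ → refl)
      osculating v _ (no ¬n) = inj₁ (one v λ where
        north _     n _ → contradiction n ¬n
        _     north _ n → contradiction n ¬n
        west  west  _ _ → refl)
      osculating v (yes w) (yes n) with flowPath-through west v w | flowPath-through north v n
      ... | r , p , P , (xs , vis) , p-enters , p-leaves | r′ , q , Q , (xs′ , vis′) , q-enters ,
        q-leaves = inj₂
        (p , q , flowPath⇒∈ P , flowPath⇒∈ Q , p≢q , enters⇒∈ west p-enters ,
          enters⇒∈ north q-enters , p-or-q ,
        (p-enters , subst (λ x → Leaves x p v) (proj₁ (exit-both F v n w)) p-leaves) ,
        (q-enters , subst (λ x → Leaves x q v) (proj₂ (exit-both F v n w)) q-leaves))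
        where
        p≢q : p ≢ q
        p≢q refl with () ← enters-unique west north (IsPath.steps (isPath P)) p-enters q-enters
        p-or-q : ∀ s → s ∈ flowPaths → v ∈ s → s ≡ p ⊎ s ≡ q
        p-or-q s s∈ v∈s with ∈⇒flowPath s∈
        ... | _ , S with flowPath-visit S v∈s
        ... | west  , _ , _ , vis″ = inj₁ (flowPath-merge S P vis″ vis)
        ... | north , _ , _ , vis″ = inj₂ (flowPath-merge S Q vis″ vis′)

    uses⇒used : ∀ {r p} e → FlowPath r p → Uses p e → T (used e)
    uses⇒used (vertical (suc r) c) P@(t , _) l with flowPath-leaves south (r , c) P l
    ... | _ , d , vis , x≡ =
      subst (λ x → T (used (outEdge x (r , c)))) x≡ (exit-used F d (r , c) (visits-used F t vis))
    uses⇒used (horizontal r (suc c)) P@(t , _) l with flowPath-leaves east (r , c) P l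
    ... | _ , d , vis , x≡ =
      subst (λ x → T (used (outEdge x (r , c)))) x≡ (exit-used F d (r , c) (visits-used F t vis))
    uses⇒used (horizontal r zero) (t , _ , refl , _) starts =
      subst (λ v → T (used (inEdge west v))) (just-injective starts) t

    used⇒uses : ∀ e → T (used e) → ∃ λ p → p ∈ flowPaths × Uses p e
    used⇒uses (vertical zero c) t = contradiction t (top-unused c)
    used⇒uses (vertical (suc r) c) t =
      let d , t′ , x≡ = exit-onto F south (r , c) t
          _ , p , P , _ , _ , leaves = flowPath-through d (r , c) t′
      in p , flowPath⇒∈ P , subst (λ x → Leaves x p (r , c)) x≡ leaves
    used⇒uses (horizontal r (suc c)) t =
      let d , t′ , x≡ = exit-onto F east (r , c) t
          _ , p , P , _ , _ , leaves = flowPath-through d (r , c) t′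
      in p , flowPath⇒∈ P , subst (λ x → Leaves x p (r , c)) x≡ leaves
    used⇒uses (horizontal r zero) t =
      let qs , tr = traceFrom west (leftEnd r) t
      in leftEnd r ∷ qs , flowPath⇒∈ (t , qs , refl , tr) , refl

  -- From nests to flows

  module _ (N : Nest m n) where

    open Nest N

    nestUses? : ∀ e → Dec (Any (λ p → Uses p e) paths)
    nestUses? e = Any.any? (λ p → uses? p e) paths

    nestUsed : Edge m n → Bool
    nestUsed e = ⌊ nestUses? e ⌋

    nestUsed⇔ : ∀ {e} → T (nestUsed e) ⇔ (∃ λ p → p ∈ paths × Uses p e)
    nestUsed⇔ {e} = mk⇔ (λ t → find (toWitness {a? = nestUses? e} t))
      (λ (p , p∈ , u) → fromWitness {a? = nestUses? e} (lose p∈ u))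

    walk : ∀ {p} → p ∈ paths → Walk p
    walk p∈ = IsPath.steps (all-paths _ p∈)

    uses-in⇒enters : ∀ d {p} (v : V) → p ∈ paths → Uses p (inEdge d v) → Enters d p v
    uses-in⇒enters west  (r , zero)  p∈ starts       = inj₁ starts
    uses-in⇒enters west  (r , suc c) p∈ (w , mv , s) =
      inj₂ (_ , (refl , cong suc (sym (Fin.toℕ-inject₁ c))) ,
      subst (HasStep _ _) (move-functional east mv (refl , cong suc (sym (Fin.toℕ-inject₁ c)))) s)
    uses-in⇒enters north (suc r , c) p∈ (inj₂ (w , mv , s)) = _ ,
      (cong suc (sym (Fin.toℕ-inject₁ r)) , refl) ,
      subst (HasStep _ _) (move-functional south mv (cong suc (sym (Fin.toℕ-inject₁ r)) , refl)) s
    -- A path ends only in the last row, whereas row `suc r` would lie below its end.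
    uses-in⇒enters north (suc r , c) p∈ (inj₁ ends) =
      let w , ends′ , bottom = IsPath.ends (all-paths _ p∈) in
      contradiction (cong suc (sym (Fin.toℕ-inject₁ r)) , refl)
        (no-move-south {v = inject₁ r , c} {w = suc r , c}
          (trans (cong (suc ∘ toℕ ∘ proj₁) (just-injective (trans (sym ends) ends′))) bottom))

    enters⇒uses-in : ∀ d {p} (v : V) → p ∈ paths → Enters d p v → Uses p (inEdge d v)
    enters⇒uses-in west  (r , zero) p∈ (inj₁ starts) = starts
    enters⇒uses-in west  (r , suc c) p∈ (inj₁ starts) =
      let w , starts′ , left = IsPath.starts (all-paths _ p∈) in
      contradiction (trans (cong (toℕ ∘ proj₂) (just-injective (trans (sym starts) starts′))) left)
        λ ()
    enters⇒uses-in west  v p∈ (inj₂ (u , mv , s)) =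
      subst (Uses _) (outEdge≡inEdge east mv) (leaves⇒uses east (v , mv , s))
    enters⇒uses-in north v p∈ (u , mv , s) =
      subst (Uses _) (outEdge≡inEdge south mv) (leaves⇒uses south (inj₂ (v , mv , s)))

    in⇔ : ∀ d v → T (nestUsed (inEdge d v)) ⇔ (∃ λ p → p ∈ paths × Enters d p v)
    in⇔ d v = mk⇔
      (λ t → let p , p∈ , u = to (nestUsed⇔ {inEdge d v}) t in p , p∈ , uses-in⇒enters d v p∈ u)
      (λ (p , p∈ , e) → from (nestUsed⇔ {inEdge d v}) (p , p∈ , enters⇒uses-in d v p∈ e))

    out⇔ : ∀ x v → T (nestUsed (outEdge x v)) ⇔ (∃ λ p → p ∈ paths × Leaves x p v)
    out⇔ south v = nestUsed⇔ {outEdge south v}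
    out⇔ east  v = nestUsed⇔ {outEdge east v}

    -- Where two paths touch, all four edges are used. Elsewhere at most one path passes, and it
    -- enters once and leaves once.
    nest-conserve : ∀ v → bit (nestUsed (inEdge north v)) + bit (nestUsed (inEdge west v)) ≡
      bit (nestUsed (outEdge south v)) + bit (nestUsed (outEdge east v))
    nest-conserve v with osculating v
    ... | inj₂ (p , q , p∈ , q∈ , _ , _ , _ , _ , (w , s) , (n , e))
      rewrite T⇒≡ (from (in⇔ west v) (p , p∈ , w)) | T⇒≡ (from (in⇔ north v) (q , q∈ , n))
            | T⇒≡ (from (out⇔ south v) (p , p∈ , s)) | T⇒≡ (from (out⇔ east v) (q , q∈ , e)) = refl
    ... | inj₁ one = balanced (nestUsed (inEdge north v)) (nestUsed (inEdge west v))
            (nestUsed (outEdge south v)) (nestUsed (outEdge east v))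
            (λ tn tw → case enters-same north west tn tw of λ ())
            (λ ts te → case leaves-same south east ts te of λ ())
            (λ where (inj₁ tn) → through north tn ; (inj₂ tw) → through west tw)
            (λ where (inj₁ ts) → back south ts ; (inj₂ te) → back east te)
      where
      enters-same : ∀ d d′ → T (nestUsed (inEdge d v)) → T (nestUsed (inEdge d′ v)) → d ≡ d′
      enters-same d d′ t t′ with to (in⇔ d v) t | to (in⇔ d′ v) t′
      ... | p , p∈ , e | q , q∈ , e′ with refl ← one p q p∈ q∈ (enters⇒∈ d e) (enters⇒∈ d′ e′) =
        enters-unique d d′ (walk p∈) e e′
      leaves-same : ∀ x x′ → T (nestUsed (outEdge x v)) → T (nestUsed (outEdge x′ v)) → x ≡ x′
      leaves-same x x′ t t′ with to (out⇔ x v) t | to (out⇔ x′ v) t′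
      ... | p , p∈ , l | q , q∈ , l′ with refl ← one p q p∈ q∈ (leaves⇒∈ x l) (leaves⇒∈ x′ l′) =
        leaves-unique x x′ (walk p∈) l l′
      through : ∀ d → T (nestUsed (inEdge d v)) → T (nestUsed (outEdge south v)) ⊎
        T (nestUsed (outEdge east v))
      through d t with to (in⇔ d v) t
      ... | p , p∈ , e with ∈⇒leaves (walk p∈) (enters⇒∈ d e)
      ... | south , l = inj₁ (from (out⇔ south v) (p , p∈ , l))
      ... | east  , l = inj₂ (from (out⇔ east v) (p , p∈ , l))
      back : ∀ x → T (nestUsed (outEdge x v)) → T (nestUsed (inEdge north v)) ⊎
        T (nestUsed (inEdge west v))
      back x t with to (out⇔ x v) t
      ... | p , p∈ , l with ∈⇒enters (walk p∈) (leaves⇒∈ x l)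
      ... | north , e = inj₁ (from (in⇔ north v) (p , p∈ , e))
      ... | west  , e = inj₂ (from (in⇔ west v) (p , p∈ , e))
      balanced : ∀ n w s e → (T n → T w → ⊥) → (T s → T e → ⊥) → (T n ⊎ T w → T s ⊎ T e) →
        (T s ⊎ T e → T n ⊎ T w) →
        bit n + bit w ≡ bit s + bit e
      balanced true  true  _     _     nw _  _ _ = ⊥-elim (nw _ _)
      balanced _     _     true  true  _  se _ _ = ⊥-elim (se _ _)
      balanced true  false false false _  _  f _ = case f (inj₁ _) of λ { (inj₁ ()) ; (inj₂ ()) }
      balanced false true  false false _  _  f _ = case f (inj₂ _) of λ { (inj₁ ()) ; (inj₂ ()) }
      balanced false false true  false _  _  _ g = case g (inj₁ _) of λ { (inj₁ ()) ; (inj₂ ()) }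
      balanced false false false true  _  _  _ g = case g (inj₂ _) of λ { (inj₁ ()) ; (inj₂ ()) }
      balanced false false false false _  _  _ _ = refl
      balanced true  false true  false _  _  _ _ = refl
      balanced true  false false true  _  _  _ _ = refl
      balanced false true  true  false _  _  _ _ = refl
      balanced false true  false true  _  _  _ _ = refl

    nest⇒flow : Flow m n
    nest⇒flow = record
      { used     = nestUsed
      ; top      = λ c → unused λ t → proj₂ (proj₂ (to (nestUsed⇔ {vertical zero c}) t))
      ; right    = λ r → unused λ t → no-exit r (to (nestUsed⇔ {horizontal r (fromℕ n)}) t)
      ; conserve = λ r c → nest-conserve (r , c)
      }
      where
      unused : ∀ {x} → ¬ T x → x ≡ false
      unused {false} _  = refl
      unused {true}  ¬t = ⊥-elim (¬t _)
      no-exit : ∀ r → ¬ (∃ λ p → p ∈ paths × Uses p (horizontal r (fromℕ n)))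
      no-exit r (p , p∈ , ((_ , c) , (_ , eq) , _)) =
        ℕ.<⇒≢ (Fin.toℕ<n c) (trans eq (cong suc (Fin.toℕ-fromℕ n-1)))

    leaves⇒exit : ∀ {p} d x v → p ∈ paths → Enters d p v → Leaves x p v → exit nestUsed d v ≡ x
    leaves⇒exit {p} d x v p∈ e l = determined d x e l
      where
      -- a path through the other exit x′ would touch p at v, and p would turn there
      unused : ∀ x x′ → x ≢ x′ → Leaves x p v → (∀ {p′ q′} → p′ ≡ p ⊎ q′ ≡ p →
        Enters west p′ v × Leaves south p′ v → Enters north q′ v × Leaves east q′ v → ⊥) →
        nestUsed (outEdge x′ v) ≡ false
      unused x x′ x≢x′ l touch with nestUsed (outEdge x′ v) in eq
      ... | false = refl
      ... | true with to (out⇔ x′ v) (from T-≡ eq) | osculating v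
      ... | q , q∈ , l′ | inj₁ one with refl ← one p q p∈ q∈ (leaves⇒∈ x l) (leaves⇒∈ x′ l′) =
        contradiction (leaves-unique x x′ (walk p∈) l l′) x≢x′
      ... | q , q∈ , l′ | inj₂ (p′ , q′ , _ , _ , _ , _ , _ , only , p′-turns , q′-turns) =
        ⊥-elim (touch (case only p p∈ (leaves⇒∈ x l) of λ where
          (inj₁ p≡) → inj₁ (sym p≡)
          (inj₂ p≡) → inj₂ (sym p≡)) p′-turns q′-turns)
      determined : ∀ d x → Enters d p v → Leaves x p v → exit nestUsed d v ≡ x
      determined west  south e l rewrite T⇒≡ (from (out⇔ south v) (p , p∈ , l)) = refl
      determined north east  e l rewrite T⇒≡ (from (out⇔ east v) (p , p∈ , l)) = refl
      determined west  east  e l rewrite unused east south (λ ()) l (λ where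
        (inj₁ refl) (_ , s) _ → case leaves-unique south east (walk p∈) s l of λ ()
        (inj₂ refl) _ (n , _) → case enters-unique north west (walk p∈) n e of λ ()) = refl
      determined north south e l rewrite unused south east (λ ()) l (λ where
        (inj₁ refl) (w , _) _ → case enters-unique west north (walk p∈) w e of λ ()
        (inj₂ refl) _ (_ , e′) → case leaves-unique east south (walk p∈) e′ l of λ ()) = refl

    nest-trace : ∀ {p d v} xs ys → p ∈ paths → p ≡ xs ++ v ∷ ys → Enters d p v →
      Trace nestUsed d v ys
    nest-trace {p} {d} {v} xs [] p∈ refl e =
      let w , ends , bottom = IsPath.ends (all-paths _ p∈) in
      stop (leaves⇒exit d south v p∈ e (inj₁ (last-++ xs)))
        (trans (cong (suc ∘ toℕ ∘ proj₁) (just-injective (trans (sym (last-++ xs)) ends))) bottom)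
    nest-trace {p} {d} {v} xs (w ∷ ys) p∈ refl e =
      let s = xs , ys , refl
          x , mv = step⇒move (hasStep⇒step (walk p∈) s)
      in move x (leaves⇒exit d x v p∈ e (move⇒leaves x mv s)) mv
        (nest-trace (xs ++ v ∷ []) ys p∈ (sym (++-assoc xs (v ∷ []) (w ∷ ys))) (move⇒enters x mv s))

  trace-cong : ∀ {f g : Edge m n → Bool} → (∀ e → f e ≡ g e) → ∀ {d v ps} → Trace f d v ps →
    Trace g d v ps
  trace-cong f≗g {d} {v} (stop eq bottom)  =
    stop (trans (cong₂ (turn d) (sym (f≗g _)) (sym (f≗g _))) eq) bottom
  trace-cong f≗g {d} {v} (move x eq mv tr) =
    move x (trans (cong₂ (turn d) (sym (f≗g _)) (sym (f≗g _))) eq) mv (trace-cong f≗g tr)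

  nest-path : ∀ (N : Nest m n) {p} → p ∈ Nest.paths N → ∃₂ λ r qs →
    p ≡ leftEnd r ∷ qs × Trace (nestUsed N) west (leftEnd r) qs
  nest-path N {[]} p∈ with () ← proj₁ (proj₂ (IsPath.starts (Nest.all-paths N _ p∈)))
  nest-path N {(r , c) ∷ qs} p∈ with IsPath.starts (Nest.all-paths N _ p∈)
  nest-path N {(r , zero) ∷ qs} p∈ | _ , refl , _ = r , qs , refl ,
    nest-trace N [] qs p∈ refl (inj₁ refl)

  -- The left border edge of a path of `N` is used in `N′` too, hence starts a path there; both are
  -- traces along the same bits from the same vertex, so they are equal.
  nest-⊆ : ∀ (N N′ : Nest m n) → (∀ e → nestUsed N e ≡ nestUsed N′ e) → ∀ {p} → p ∈ Nest.paths N →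
    p ∈ Nest.paths N′
  nest-⊆ N N′ eq {p} p∈ with nest-path N p∈
  ... | r , qs , refl ,
    tr with to (nestUsed⇔ N′ {horizontal r zero})
    (subst T (eq (horizontal r zero)) (from (nestUsed⇔ N {horizontal r zero}) (p , p∈ , refl)))
  ... | p′ , p′∈ , starts with nest-path N′ p′∈
  ... | r′ , qs′ , refl , tr′ with refl ← just-injective starts
    with refl ← trace-unique (nestUsed N′) (trace-cong eq tr) tr′ = p′∈

  nestUsed-⊆ : ∀ (N N′ : Nest m n) → (∀ {p} → p ∈ Nest.paths N → p ∈ Nest.paths N′) → ∀ e →
    T (nestUsed N e) → T (nestUsed N′ e)
  nestUsed-⊆ N N′ ⊆ e t =
    let p , p∈ , u = to (nestUsed⇔ N {e}) t
    in from (nestUsed⇔ N′ {e}) (p , ⊆ p∈ , u)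

nest↔flow : ∀ m n-1 → Bijection (nests m (suc n-1)) (flows m (suc n-1))
nest↔flow m n-1 = bijection nest⇒flow
  (λ {N} {N′} N≈N′ e → T⇔⇒≡ (nestUsed-⊆ N N′ (to N≈N′) e) (nestUsed-⊆ N′ N (from N≈N′) e))
  (λ {N} {N′} eq → mk⇔ (nest-⊆ N N′ eq) (nest-⊆ N′ N (sym ∘ eq)))
  (λ F → flow⇒nest F , λ e → T⇔⇒≡
    (λ t →
        let p , p∈ , u = to (nestUsed⇔ (flow⇒nest F) {e}) t
        in uses⇒used F e (proj₂ (∈⇒flowPath F p∈)) u)
    (λ t → from (nestUsed⇔ (flow⇒nest F) {e}) (used⇒uses F e t)))

-- Composing the bijections

increments-bijection : ∀ m n .{{_ : NonZero n}} A → Bijection (setOf A m n) (increments m n)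
increments-bijection m n         pasm     = asm↔increments m n
increments-bijection m n         triangle = Bijection.trans (triangle↔ideal m n)
  (Bijection.trans (ideal↔cornerSum m n) (cornerSum↔increments m n))
increments-bijection m n         height   = height↔increments m n
increments-bijection m n         fpl      = fpl↔increments m n
increments-bijection m n         ice      = ice↔increments m n
increments-bijection m n         ideal    = Bijection.trans (orderIdeal↔ideal m n)
  (Bijection.trans (ideal↔cornerSum m n) (cornerSum↔increments m n))
-- Matching on n provides the first column, where paths start.
increments-bijection m (suc n-1) nest     =
  Bijection.trans (nest↔flow m n-1) (flow↔increments m (suc n-1))

theorem3p3 : ∀ (m n : ℕ) .{{_ : NonZero m}} .{{_ : NonZero n}} →
    ∀ (A B : Family) → Bijection (setOf A m n) (setOf B m n)
theorem3p3 m n A B = Bijection.trans (increments-bijection m n A)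
  (Inverse⇒Bijection (Inverse.sym (Bijection⇒Inverse (increments-bijection m n B))))
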